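{- Let $\{G_n\}_{n\ge0}$ be a strongly polynomial sequence of graphs. Then the chromatic polynomials $\{\chi(G_n,x)\}_{n\ge 0}$ and the characteristic polynomials $\{\psi(G_n,x)\}_{n\ge0}$ (polynomials in $x$, indexed by $n$) are both two-level polynomials of infinite depth.
   Context: Graphs are finite and simple. $\hom(F,G)$ denotes the number of graph homomorphisms (edge-preserving vertex maps) from $F$ to $G$. A sequence $\{G_n\}_{n\ge0}$ of graphs is strongly polynomial if for every fixed graph $F$ there is a polynomial $p_F$ such that $\hom(F,G_n)=p_F(n)$ for all $n\ge 0$. The chromatic polynomial $\chi(G,x)$ is the unique polynomial whose value at each natural number $m$ is the number of proper $m$-colorings of $G$. The characteristic polynomial $\psi(G,x)$ is the characteristic polynomial of the adjacency matrix of $G$. A numerical polynomial is $g\in\mathbb Q[x]$ with $g(q)\in\mathbb Z$ for all $q\in\mathbb Z$. Two-level polynomial: let $g$ be an eventually nonnegative numerical polynomial, $S=\{q\in\mathbb N: g(q)\ge0\}$, and $e:S\to\mathbb N\cup\{ -1,\infty\}$. A sequence of polynomials $\{f_q(x)\}_{q\in S}$, with $f_q$ of degree $g(q)$, is a two-level polynomial of degree function $g$ and depth function $e$ if, writing $f_q(x)=\sum_{r=0}^\infty c_r(q)x^{g(q)-r}$ with $c_r(q)=0$ for $r>g(q)$, there exist polynomials $\{\varphi_r(q)\}_{r\ge0}$ such that $c_r(q)=\varphi_r(q)$ for every $q\in S$ and every $r\le e(q)$. (For $q\in\mathbb N\setminus S$ one sets $f_q=0$, $e(q)=-1$.) Infinite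 depth means $e(q)=\infty$ for all $q\in S$. In the claim the index $n$ plays the role of $q$. -}

module Defs where

open import Data.Bool.Base using (Bool; true; false; if_then_else_; T)
open import Data.Bool.Properties using (T?)
open import Data.Fin.Base as Fin using (Fin; zero; suc; punchOut)
open import Data.Fin.Properties as Fin using (all?; punchIn-punchOut)
open import Data.Integer.Base as ℤ using (ℤ)
open import Data.List.Base as List using (List; []; _∷_; _++_; filter; length; allFin; cartesianProduct; cartesianProductWith; foldr; tabulate)
open import Data.List.Membership.Propositional using (_∈_)
open import Data.List.Membership.Propositional.Properties using (∈-allFin; ∈-cartesianProduct⁺; ∈-filter⁺; ∈-filter⁻)
open import Data.List.Relation.Unary.All as All using (All)
open import Data.List.Relation.Unary.Any using (here; there)
open import Data.Nat.Base as ℕ using (ℕ; zero; suc)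
import Data.Nat.Properties as ℕ
open import Data.Product.Base as Product using (∃-syntax; Σ-syntax; _×_; _,_; proj₁; proj₂)
open import Data.Rational.Base using (ℚ; 0ℚ; 1ℚ; _+_; _*_; -_; _≤_)
open import Data.Rational.Literals using (fromℤ)
open import Data.Rational.Properties as ℚ using (+-*-commutativeRing)
open import Data.Rational.Unnormalised.Base using (*≡*)
open import Data.Sum.Base using (_⊎_; inj₁; inj₂)
open import Data.Vec.Base as Vec using (Vec; []; _∷_; lookup; insertAt)
open import Data.Vec.Properties using (insertAt-lookup; insertAt-punchIn)
open import Algebra.Bundles using (CommutativeRing)
open import Function.Base using (_∘_; id)
open import Relation.Binary.Construct.Add.Extrema.NonStrict ℕ._≤_ using (_≤±_)
open import Relation.Binary.PropositionalEquality using (_≡_; _≢_; refl; sym; trans; cong; cong₂; module ≡-Reasoning)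
open import Relation.Nullary using (Dec; yes; no; does; ¬_; contradiction; ¬?)
open import Relation.Nullary.Decidable using (_→-dec_; _×-dec_; dec-true; dec-false)
open import Relation.Nullary.Construct.Add.Extrema using (_±; ⊥±; ⊤±; [_])
open import Relation.Unary using (Decidable)

------------------------------------------------------------------------
-- Graphs and homomorphism counts

record Graph : Set where
  field
    order  : ℕ
    adj    : Fin order → Fin order → Bool
    symm   : ∀ u v → T (adj u v) → T (adj v u)
    irrefl : ∀ v → ¬ T (adj v v)

open Graph public

-- All maps Fin k → Fin n, each listed exactly once as its vector of values.
maps : (k n : ℕ) → List (Vec (Fin n) k)
maps zero    n = [] ∷ []
maps (suc k) n = cartesianProductWith _∷_ (allFin n) (maps k n)

IsHom : (F G : Graph) → Vec (Fin (order G)) (order F) → Set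
IsHom F G f = ∀ u v → T (adj F u v) → T (adj G (lookup f u) (lookup f v))

isHom? : (F G : Graph) → Decidable (IsHom F G)
isHom? F G f = all? λ u → all? λ v → T? (adj F u v) →-dec T? (adj G (lookup f u) (lookup f v))

hom : Graph → Graph → ℕ
hom F G = length (filter (isHom? F G) (maps (order F) (order G)))

IsProperColouring : (G : Graph) (m : ℕ) → Vec (Fin m) (order G) → Set
IsProperColouring G m c = ∀ u v → T (adj G u v) → lookup c u ≢ lookup c v

isProperColouring? : (G : Graph) (m : ℕ) → Decidable (IsProperColouring G m)
isProperColouring? G m c = all? λ u → all? λ v → T? (adj G u v) →-dec ¬? (lookup c u Fin.≟ lookup c v)

#properColourings : Graph → ℕ → ℕ
#properColourings G m = length (filter (isProperColouring? G m) (maps (order G) m))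

------------------------------------------------------------------------
-- Polynomials over ℚ

-- Coefficients in order of increasing degree.  Trailing zeros are allowed, so
-- a polynomial is determined by `coeff`, not by propositional equality.
Polynomial : Set
Polynomial = List ℚ

fromℕ : ℕ → ℚ
fromℕ n = fromℤ (ℤ.+ n)

coeff : Polynomial → ℕ → ℚ
coeff []      _       = 0ℚ
coeff (a ∷ p) zero    = a
coeff (a ∷ p) (suc i) = coeff p i

eval : Polynomial → ℚ → ℚ
eval []      x = 0ℚ
eval (a ∷ p) x = a + x * eval p x

HasDegree : Polynomial → ℕ → Set
HasDegree p d = coeff p d ≢ 0ℚ × (∀ i → d ℕ.< i → coeff p i ≡ 0ℚ)

-- The coefficient of x^(d - r), which is zero for r > d.
coeffBelow : Polynomial → (d r : ℕ) → ℚ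
coeffBelow p d r = if r ℕ.≤ᵇ d then coeff p (d ℕ.∸ r) else 0ℚ

infixl 6 _⊕_
infixl 7 _⊗_

const : ℚ → Polynomial
const a = a ∷ []

X : Polynomial
X = 0ℚ ∷ 1ℚ ∷ []

_⊕_ : Polynomial → Polynomial → Polynomial
[]      ⊕ q       = q
(a ∷ p) ⊕ []      = a ∷ p
(a ∷ p) ⊕ (b ∷ q) = a + b ∷ p ⊕ q

scale : ℚ → Polynomial → Polynomial
scale a = List.map (a *_)

neg : Polynomial → Polynomial
neg = List.map -_

_⊗_ : Polynomial → Polynomial → Polynomial
[]      ⊗ q = []
(a ∷ p) ⊗ q = scale a q ⊕ (0ℚ ∷ p ⊗ q)

------------------------------------------------------------------------
-- Strongly polynomial sequences

StronglyPolynomial : (ℕ → Graph) → Set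
StronglyPolynomial G = ∀ F → ∃[ p ] ∀ n → fromℕ (hom F (G n)) ≡ eval p (fromℕ n)

------------------------------------------------------------------------
-- Characteristic polynomial

IsInjective : ∀ {n} → Vec (Fin n) n → Set
IsInjective {n} σ = ∀ (i j : Fin n) → lookup σ i ≡ lookup σ j → i ≡ j

isInjective? : ∀ {n} → Decidable (IsInjective {n})
isInjective? σ = all? λ i → all? λ j → (lookup σ i Fin.≟ lookup σ j) →-dec (i Fin.≟ j)

permutations : ∀ n → List (Vec (Fin n) n)
permutations n = filter isInjective? (maps n n)

inversions : ∀ {n} → Vec (Fin n) n → ℕ
inversions {n} σ = length (filter inverted? (cartesianProduct (allFin n) (allFin n)))
  where
  inverted? : Decidable {A = Fin n × Fin n} (λ (i , j) → i Fin.< j × lookup σ j Fin.< lookup σ i)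
  inverted? (i , j) = (i Fin.<? j) ×-dec (lookup σ j Fin.<? lookup σ i)

signed : ℕ → Polynomial → Polynomial
signed zero    p = p
signed (suc k) p = neg (signed k p)

-- The Leibniz formula.
det : ∀ n → (Fin n → Fin n → Polynomial) → Polynomial
det n M = foldr _⊕_ [] (List.map term (permutations n))
  where
  term : Vec (Fin n) n → Polynomial
  term σ = signed (inversions σ) (foldr _⊗_ (const 1ℚ) (tabulate λ i → M i (lookup σ i)))

adjacencyMatrix : (G : Graph) → Fin (order G) → Fin (order G) → ℚ
adjacencyMatrix G u v = if adj G u v then 1ℚ else 0ℚ

characteristicPolynomial : Graph → Polynomial
characteristicPolynomial G = det (order G) λ u v →
  (if does (u Fin.≟ v) then X else []) ⊕ neg (const (adjacencyMatrix G u v))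

------------------------------------------------------------------------
-- Two-level polynomials

IsNumerical : Polynomial → Set
IsNumerical g = ∀ (q : ℤ) → ∃[ z ] eval g (fromℤ q) ≡ fromℤ z

EventuallyNonnegative : Polynomial → Set
EventuallyNonnegative g = ∃[ N ] ∀ q → N ℕ.≤ q → 0ℚ ≤ eval g (fromℕ q)

infix 4 _∈S[_]
_∈S[_] : ℕ → Polynomial → Set
q ∈S[ g ] = 0ℚ ≤ eval g (fromℕ q)

-- Depths live in ℕ ± , where ⊥± stands for -1 and ⊤± for ∞.  As g is numerical,
-- the q in S are exactly those for which g(q) is some natural number d, so
-- `eval g (fromℕ q) ≡ fromℕ d` says "q ∈ S and d = g(q)".  Off S the sequence
-- f and the depth e take the conventional values 0 and -1.
record IsTwoLevelPolynomial (g : Polynomial) (e : ℕ → ℕ ±) (f : ℕ → Polynomial) : Set where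
  field
    numerical             : IsNumerical g
    eventuallyNonnegative : EventuallyNonnegative g
    degree                : ∀ q d → eval g (fromℕ q) ≡ fromℕ d → HasDegree (f q) d
    coefficients          : Σ[ φ ∈ (ℕ → Polynomial) ] ∀ q d → eval g (fromℕ q) ≡ fromℕ d → ∀ r → [ r ] ≤± e q →
                              coeffBelow (f q) d r ≡ eval (φ r) (fromℕ q)
    off-S-zero            : ∀ q → ¬ q ∈S[ g ] → ∀ i → coeff (f q) i ≡ 0ℚ
    off-S-depth           : ∀ q → ¬ q ∈S[ g ] → e q ≡ ⊥±

IsTwoLevelPolynomialOfInfiniteDepth : (ℕ → Polynomial) → Set
IsTwoLevelPolynomialOfInfiniteDepth f =
  ∃[ g ] ∃[ e ] IsTwoLevelPolynomial g e f × (∀ q → q ∈S[ g ] → e q ≡ ⊤±)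

------------------------------------------------------------------------
-- Chromatic polynomial

IsChromaticPolynomial : Graph → Polynomial → Set
IsChromaticPolynomial G p = ∀ m → eval p (fromℕ m) ≡ fromℕ (#properColourings G m)

-- Existence, by deletion–contraction.  A list of constraints (i , j) asks that
-- vertices i and j get different colours.

open CommutativeRing +-*-commutativeRing using (semiring; +-commutativeMonoid)
open import Algebra.Properties.CommutativeMonoid.Sum +-commutativeMonoid using (sum; sum-cong-≗; ∑-distrib-+; ∑-comm)
open import Algebra.Properties.Semiring.Sum semiring using (*-distribʳ-sum)
open import Algebra.Properties.Ring (CommutativeRing.ring +-*-commutativeRing) using (-‿+-comm; -‿distribʳ-*)
open import Algebra.Properties.CommutativeSemigroup (CommutativeRing.+-commutativeSemigroup +-*-commutativeRing) using (interchange)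
open ≡-Reasoning

Constraints : ℕ → ℕ → Set
Constraints n k = Vec (Fin n × Fin n) k

-- Identifies vertex j with i and renumbers the remaining vertices.
merge : ∀ {n} {i j : Fin (suc n)} → j ≢ i → Fin (suc n) → Fin n
merge {j = j} j≢i v with j Fin.≟ v
... | yes _  = punchOut j≢i
... | no j≢v = punchOut j≢v

monomial : ℕ → Polynomial
monomial zero    = const 1ℚ
monomial (suc n) = 0ℚ ∷ monomial n

delCon : ∀ n {k} → Constraints n k → Polynomial
delCon n       []             = monomial n
delCon (suc n) ((i , j) ∷ es) with j Fin.≟ i
... | yes _  = []
... | no j≢i = delCon (suc n) es ⊕ neg (delCon n (Vec.map (Product.map (merge j≢i) (merge j≢i)) es))

edges : (G : Graph) → List (Fin (order G) × Fin (order G))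
edges G = filter (λ (u , v) → T? (adj G u v)) (cartesianProduct (allFin _) (allFin _))

chromaticPolynomial : Graph → Polynomial
chromaticPolynomial G = delCon (order G) (Vec.fromList (edges G))

fromℕ-suc : ∀ n → fromℕ (suc n) ≡ 1ℚ + fromℕ n
fromℕ-suc n = ℚ.toℚᵘ-injective (ℚᵘ.≃-trans lemma (ℚᵘ.≃-sym (ℚ.toℚᵘ-homo-+ 1ℚ (fromℕ n))))
  where
  import Data.Rational.Unnormalised.Base as ℚᵘ
  import Data.Rational.Unnormalised.Properties as ℚᵘ
  import Data.Integer.Properties as ℤ
  open import Data.Rational.Base using (toℚᵘ)
  lemma : toℚᵘ (fromℕ (suc n)) ℚᵘ.≃ toℚᵘ 1ℚ ℚᵘ.+ toℚᵘ (fromℕ n)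
  lemma = *≡* (cong (ℤ._* ℤ.1ℤ) (cong (ℤ._+_ ℤ.1ℤ) (sym (ℤ.*-identityʳ (ℤ.+ n)))))

eval-⊕ : ∀ p q x → eval (p ⊕ q) x ≡ eval p x + eval q x
eval-⊕ []      q       x = sym (ℚ.+-identityˡ _)
eval-⊕ (a ∷ p) []      x = sym (ℚ.+-identityʳ _)
eval-⊕ (a ∷ p) (b ∷ q) x = begin
  a + b + x * eval (p ⊕ q) x            ≡⟨ cong (λ y → a + b + x * y) (eval-⊕ p q x) ⟩
  a + b + x * (eval p x + eval q x)     ≡⟨ cong (a + b +_) (ℚ.*-distribˡ-+ x _ _) ⟩
  a + b + (x * eval p x + x * eval q x) ≡⟨ interchange a b _ _ ⟩
  a + x * eval p x + (b + x * eval q x) ∎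

eval-neg : ∀ p x → eval (neg p) x ≡ - eval p x
eval-neg []      x = refl
eval-neg (a ∷ p) x = begin
  - a + x * eval (neg p) x  ≡⟨ cong (λ y → - a + x * y) (eval-neg p x) ⟩
  - a + x * - eval p x      ≡⟨ cong (- a +_) (sym (-‿distribʳ-* x _)) ⟩
  - a + - (x * eval p x)    ≡⟨ -‿+-comm a _ ⟩
  - (a + x * eval p x)      ∎

∑-neg : ∀ {n} (f : Fin n → ℚ) → sum (λ i → - f i) ≡ - sum f
∑-neg {zero}  f = refl
∑-neg {suc n} f = trans (cong (- f zero +_) (∑-neg (f ∘ suc))) (-‿+-comm (f zero) (sum (f ∘ suc)))

∑-zero : ∀ n → sum {n} (λ _ → 0ℚ) ≡ 0ℚ
∑-zero zero    = refl
∑-zero (suc n) = trans (ℚ.+-identityˡ _) (∑-zero n)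

∑-one : ∀ n → sum {n} (λ _ → 1ℚ) ≡ fromℕ n
∑-one zero    = refl
∑-one (suc n) = trans (cong (1ℚ +_) (∑-one n)) (sym (fromℕ-suc n))

∑-point : ∀ {m} (x : Fin m) (f : Fin m → ℚ) → sum (λ a → if does (x Fin.≟ a) then f a else 0ℚ) ≡ f x
∑-point {suc m} zero    f = trans (cong (f zero +_) (∑-zero m)) (ℚ.+-identityʳ _)
∑-point {suc m} (suc x) f = trans (ℚ.+-identityˡ _) (∑-point x (f ∘ suc))

∑ᵛ : ∀ n {m} → (Vec (Fin m) n → ℚ) → ℚ
∑ᵛ zero    f = f []
∑ᵛ (suc n) f = sum λ a → ∑ᵛ n (f ∘ (a ∷_))

∑ᵛ-cong : ∀ n {m} {f g : Vec (Fin m) n → ℚ} → (∀ c → f c ≡ g c) → ∑ᵛ n f ≡ ∑ᵛ n g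
∑ᵛ-cong zero    eq = eq []
∑ᵛ-cong (suc n) eq = sum-cong-≗ λ a → ∑ᵛ-cong n λ c → eq (a ∷ c)

∑ᵛ-+ : ∀ n {m} (f g : Vec (Fin m) n → ℚ) → ∑ᵛ n (λ c → f c + g c) ≡ ∑ᵛ n f + ∑ᵛ n g
∑ᵛ-+ zero    f g = refl
∑ᵛ-+ (suc n) f g = trans (sum-cong-≗ λ a → ∑ᵛ-+ n (f ∘ (a ∷_)) (g ∘ (a ∷_))) (∑-distrib-+ (λ a → ∑ᵛ n (f ∘ (a ∷_))) (λ a → ∑ᵛ n (g ∘ (a ∷_))))

∑ᵛ-neg : ∀ n {m} (f : Vec (Fin m) n → ℚ) → ∑ᵛ n (λ c → - f c) ≡ - ∑ᵛ n f
∑ᵛ-neg zero    f = refl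
∑ᵛ-neg (suc n) f = trans (sum-cong-≗ λ a → ∑ᵛ-neg n (f ∘ (a ∷_))) (∑-neg (λ a → ∑ᵛ n (f ∘ (a ∷_))))

∑ᵛ-zero : ∀ n {m} → ∑ᵛ n {m} (λ _ → 0ℚ) ≡ 0ℚ
∑ᵛ-zero zero        = refl
∑ᵛ-zero (suc n) {m} = trans (sum-cong-≗ {m} λ _ → ∑ᵛ-zero n) (∑-zero m)

∑ᵛ-∑ : ∀ n {m l} (f : Fin l → Vec (Fin m) n → ℚ) → sum (λ a → ∑ᵛ n (f a)) ≡ ∑ᵛ n (λ c → sum λ a → f a c)
∑ᵛ-∑ zero    f = refl
∑ᵛ-∑ (suc n) f = trans (∑-comm (λ a b → ∑ᵛ n (f a ∘ (b ∷_)))) (sum-cong-≗ λ b → ∑ᵛ-∑ n λ a → f a ∘ (b ∷_))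

∑ᵛ-insertAt : ∀ n {m} (j : Fin (suc n)) (f : Vec (Fin m) (suc n) → ℚ) →
              ∑ᵛ (suc n) f ≡ ∑ᵛ n (λ c → sum λ a → f (insertAt c j a))
∑ᵛ-insertAt n       zero    f = ∑ᵛ-∑ n (λ a → f ∘ (a ∷_))
∑ᵛ-insertAt (suc n) (suc j) f = sum-cong-≗ λ b → ∑ᵛ-insertAt n j (f ∘ (b ∷_))

monomial-count : ∀ n m → eval (monomial n) (fromℕ m) ≡ ∑ᵛ n {m} (λ _ → 1ℚ)
monomial-count zero    m = trans (cong (1ℚ +_) (ℚ.*-zeroʳ (fromℕ m))) (ℚ.+-identityʳ 1ℚ)
monomial-count (suc n) m = begin
  0ℚ + fromℕ m * eval (monomial n) (fromℕ m)  ≡⟨ ℚ.+-identityˡ _ ⟩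
  fromℕ m * eval (monomial n) (fromℕ m)       ≡⟨ cong₂ _*_ (sym (∑-one m)) (monomial-count n m) ⟩
  sum {m} (λ _ → 1ℚ) * N                      ≡⟨ *-distribʳ-sum {m} N (λ _ → 1ℚ) ⟩
  sum {m} (λ _ → 1ℚ * N)                      ≡⟨ sum-cong-≗ {m} (λ _ → ℚ.*-identityˡ N) ⟩
  sum {m} (λ _ → N)                           ∎
  where N = ∑ᵛ n {m} (λ _ → 1ℚ)

satisfies : ∀ {n k m} → Constraints n k → Vec (Fin m) n → ℚ
satisfies []             c = 1ℚ
satisfies ((i , j) ∷ es) c = if does (lookup c i Fin.≟ lookup c j) then 0ℚ else satisfies es c

lookup-merge : ∀ {n m} {i j : Fin (suc n)} (j≢i : j ≢ i) (c : Vec (Fin m) n) v →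
               lookup (insertAt c j (lookup c (punchOut j≢i))) v ≡ lookup c (merge j≢i v)
lookup-merge {j = j} j≢i c v with j Fin.≟ v
... | yes refl = insertAt-lookup c j _
... | no j≢v   = trans (cong (lookup (insertAt c j _)) (sym (punchIn-punchOut j≢v))) (insertAt-punchIn c j _ (punchOut j≢v))

satisfies-merge : ∀ {n k m} {i j : Fin (suc n)} (j≢i : j ≢ i) (es : Constraints (suc n) k) (c : Vec (Fin m) n) →
                  satisfies es (insertAt c j (lookup c (punchOut j≢i))) ≡
                  satisfies (Vec.map (Product.map (merge j≢i) (merge j≢i)) es) c
satisfies-merge j≢i []             c = refl
satisfies-merge j≢i ((u , v) ∷ es) c
  rewrite lookup-merge j≢i c u | lookup-merge j≢i c v | satisfies-merge j≢i es c = refl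

∑ᵛ-contract : ∀ {n m} {i j : Fin (suc n)} (j≢i : j ≢ i) (f : Vec (Fin m) (suc n) → ℚ) →
              ∑ᵛ (suc n) (λ c → if does (lookup c i Fin.≟ lookup c j) then f c else 0ℚ) ≡
              ∑ᵛ n (λ c → f (insertAt c j (lookup c (punchOut j≢i))))
∑ᵛ-contract {n} {i = i} {j} j≢i f =
  trans (∑ᵛ-insertAt n j (λ c → if does (lookup c i Fin.≟ lookup c j) then f c else 0ℚ)) (∑ᵛ-cong n λ c →
  trans (sum-cong-≗ λ a → cong₂ (λ x y → if does (x Fin.≟ y) then f (insertAt c j a) else 0ℚ)
           (trans (cong (lookup (insertAt c j a)) (sym (punchIn-punchOut j≢i))) (insertAt-punchIn c j a (punchOut j≢i)))
           (insertAt-lookup c j a))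
        (∑-point (lookup c (punchOut j≢i)) (λ a → f (insertAt c j a))))

split : ∀ b (x : ℚ) → (if b then 0ℚ else x) ≡ x + - (if b then x else 0ℚ)
split true  x = sym (ℚ.+-inverseʳ x)
split false x = sym (ℚ.+-identityʳ x)

delCon-count : ∀ n {k} (es : Constraints n k) m → eval (delCon n es) (fromℕ m) ≡ ∑ᵛ n {m} (satisfies es)
delCon-count n       []             m = monomial-count n m
delCon-count (suc n) ((i , j) ∷ es) m with j Fin.≟ i
... | yes refl = sym (trans (∑ᵛ-cong (suc n) looped) (∑ᵛ-zero (suc n) {m}))
  where
  looped : ∀ (c : Vec (Fin m) (suc n)) → (if does (lookup c i Fin.≟ lookup c i) then 0ℚ else satisfies es c) ≡ 0ℚ
  looped c with lookup c i Fin.≟ lookup c i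
  ... | yes _ = refl
  ... | no diff = contradiction refl diff
... | no j≢i = begin
  eval (P ⊕ neg Q) x                               ≡⟨ eval-⊕ P (neg Q) x ⟩
  eval P x + eval (neg Q) x                        ≡⟨ cong (eval P x +_) (eval-neg Q x) ⟩
  eval P x + - eval Q x                            ≡⟨ cong₂ (λ y z → y + - z) (delCon-count (suc n) es m) (delCon-count n es′ m) ⟩
  ∑ᵛ (suc n) deleted + - ∑ᵛ n contracted           ≡⟨ cong (λ z → ∑ᵛ (suc n) deleted + - z) contract ⟨
  ∑ᵛ (suc n) deleted + - ∑ᵛ (suc n) equal          ≡⟨ cong (∑ᵛ (suc n) deleted +_) (∑ᵛ-neg (suc n) equal) ⟨
  ∑ᵛ (suc n) deleted + ∑ᵛ (suc n) (λ c → - equal c) ≡⟨ ∑ᵛ-+ (suc n) deleted (λ c → - equal c) ⟨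
  ∑ᵛ (suc n) (λ c → deleted c + - equal c)         ≡⟨ ∑ᵛ-cong (suc n) (λ c → split (does (lookup c i Fin.≟ lookup c j)) (deleted c)) ⟨
  ∑ᵛ (suc n) {m} (satisfies ((i , j) ∷ es))        ∎
  where
  x   = fromℕ m
  es′ = Vec.map (Product.map (merge j≢i) (merge j≢i)) es
  P   = delCon (suc n) es
  Q   = delCon n es′
  deleted equal : Vec (Fin m) (suc n) → ℚ
  deleted = satisfies es
  equal c = if does (lookup c i Fin.≟ lookup c j) then deleted c else 0ℚ
  contracted : Vec (Fin m) n → ℚ
  contracted = satisfies es′
  contract : ∑ᵛ (suc n) equal ≡ ∑ᵛ n contracted
  contract = trans (∑ᵛ-contract j≢i deleted) (∑ᵛ-cong n (satisfies-merge j≢i es))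

module _ {A : Set} where

  ∑ˡ : (A → ℚ) → List A → ℚ
  ∑ˡ f = foldr (λ a s → f a + s) 0ℚ

  ∑ˡ-++ : ∀ f xs ys → ∑ˡ f (xs ++ ys) ≡ ∑ˡ f xs + ∑ˡ f ys
  ∑ˡ-++ f []       ys = sym (ℚ.+-identityˡ _)
  ∑ˡ-++ f (x ∷ xs) ys = trans (cong (f x +_) (∑ˡ-++ f xs ys)) (sym (ℚ.+-assoc (f x) _ _))

  length-filter : ∀ {P : A → Set} (P? : Decidable P) xs →
                  fromℕ (length (filter P? xs)) ≡ ∑ˡ (λ a → if does (P? a) then 1ℚ else 0ℚ) xs
  length-filter P? []       = refl
  length-filter P? (x ∷ xs) with does (P? x)
  ... | true  = trans (fromℕ-suc (length (filter P? xs))) (cong (1ℚ +_) (length-filter P? xs))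
  ... | false = trans (length-filter P? xs) (sym (ℚ.+-identityˡ _))

∑ˡ-map : ∀ {A B : Set} (f : B → ℚ) (h : A → B) xs → ∑ˡ f (List.map h xs) ≡ ∑ˡ (f ∘ h) xs
∑ˡ-map f h []       = refl
∑ˡ-map f h (x ∷ xs) = cong (f (h x) +_) (∑ˡ-map f h xs)

∑ˡ-maps : ∀ n m (f : Vec (Fin m) n → ℚ) → ∑ˡ f (maps n m) ≡ ∑ᵛ n f
∑ˡ-maps zero    m f = ℚ.+-identityʳ (f [])
∑ˡ-maps (suc n) m f = heads id
  where
  heads : ∀ {l} (h : Fin l → Fin m) →
          ∑ˡ f (cartesianProductWith _∷_ (tabulate h) (maps n m)) ≡ sum (λ a → ∑ᵛ n (f ∘ (h a ∷_)))
  heads {zero}  h = refl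
  heads {suc l} h = trans (∑ˡ-++ f (List.map (h zero ∷_) (maps n m)) _)
    (cong₂ _+_ (trans (∑ˡ-map f (h zero ∷_) (maps n m)) (∑ˡ-maps n m (f ∘ (h zero ∷_)))) (heads (h ∘ suc)))

satisfies-fromList : ∀ {n m} (es : List (Fin n × Fin n)) (c : Vec (Fin m) n) →
  (satisfies (Vec.fromList es) c ≡ 1ℚ × All (λ (i , j) → lookup c i ≢ lookup c j) es) ⊎
  (satisfies (Vec.fromList es) c ≡ 0ℚ × ∃[ i ] ∃[ j ] (i , j) ∈ es × lookup c i ≡ lookup c j)
satisfies-fromList []             c = inj₁ (refl , All.[])
satisfies-fromList ((i , j) ∷ es) c with lookup c i Fin.≟ lookup c j
... | yes same = inj₂ (refl , i , j , here refl , same)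
... | no  diff with satisfies-fromList es c
...   | inj₁ (eq , all)                  = inj₁ (eq , diff All.∷ all)
...   | inj₂ (eq , u , v , e∈es , same)  = inj₂ (eq , u , v , there e∈es , same)

indicator-yes : ∀ {A : Set} (A? : Dec A) → A → (if does A? then 1ℚ else 0ℚ) ≡ 1ℚ
indicator-yes A? a = cong (if_then 1ℚ else 0ℚ) (dec-true A? a)

indicator-no : ∀ {A : Set} (A? : Dec A) → ¬ A → (if does A? then 1ℚ else 0ℚ) ≡ 0ℚ
indicator-no A? ¬a = cong (if_then 1ℚ else 0ℚ) (dec-false A? ¬a)

satisfies-edges : ∀ G m c →
  (if does (isProperColouring? G m c) then 1ℚ else 0ℚ) ≡ satisfies (Vec.fromList (edges G)) c
satisfies-edges G m c = go (satisfies-fromList (edges G) c)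
  where
  pairs = cartesianProduct (allFin (order G)) (allFin (order G))
  adj? : Decidable {A = Fin (order G) × Fin (order G)} (λ (u , v) → T (adj G u v))
  adj? (u , v) = T? (adj G u v)
  go : _ → _
  go (inj₁ (eq , all)) = trans
    (indicator-yes (isProperColouring? G m c) λ u v uv →
      All.lookup all (∈-filter⁺ adj? (∈-cartesianProduct⁺ (∈-allFin u) (∈-allFin v)) uv))
    (sym eq)
  go (inj₂ (eq , u , v , e∈es , same)) = trans
    (indicator-no (isProperColouring? G m c) λ proper →
      proper u v (proj₂ (∈-filter⁻ adj? {xs = pairs} e∈es)) same)
    (sym eq)

chromaticPolynomial-correct : ∀ G → IsChromaticPolynomial G (chromaticPolynomial G)
chromaticPolynomial-correct G m = begin
  eval (chromaticPolynomial G) (fromℕ m)             ≡⟨ delCon-count (order G) (Vec.fromList (edges G)) m ⟩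
  ∑ᵛ (order G) (satisfies (Vec.fromList (edges G)))  ≡⟨ ∑ᵛ-cong (order G) (satisfies-edges G m) ⟨
  ∑ᵛ (order G) proper                                ≡⟨ ∑ˡ-maps (order G) m proper ⟨
  ∑ˡ proper (maps (order G) m)                       ≡⟨ length-filter (isProperColouring? G m) (maps (order G) m) ⟨
  fromℕ (#properColourings G m)                      ∎
  where
  proper : Vec (Fin m) (order G) → ℚ
  proper c = if does (isProperColouring? G m c) then 1ℚ else 0ℚ

{-# OPTIONS --safe #-}
module Submission where

-- Write f(x) = ∑ c(r) x^(g - r) and study the coefficients c(r) "from the top".
-- A sum over all k-tuples of vertices of a Boolean or rational expression in
-- adjacencies and equalities of the entries is a rational combination of
-- homomorphism counts, hence polynomial in n along a strongly polynomial
-- sequence.  So it is enough to bring c(r) into that form.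
--
-- Chromatic polynomial: by Whitney's expansion c(r) is the sum of (-1)^|A| over
-- the edge sets A of rank r.  Such an A touches at most 2r vertices, so |A| is
-- bounded, and the sum over sets of s edges is 1/s! times a sum over s-tuples of
-- distinct edges.
--
-- Characteristic polynomial: c(r) is the coefficient of y^r in det(I - y A).
-- The adjugate identity and Euler's identity for the determinant give Newton's
-- recursion, which expresses c(r) through c(0), ..., c(r - 1) and the numbers
-- tr(A^s) of closed walks.

open import Defs
open import Algebra.Bundles using (CommutativeRing)
open import Data.Bool.Base using (Bool; true; false; if_then_else_; T; _∧_; _∨_; not)
open import Data.Bool.Properties using (T?; T-∨; T-∧; ∧-zeroʳ; ∧-commutativeMonoid)
open import Data.Fin.Base as Fin using (Fin; zero; suc; punchOut)
open import Data.Fin.Properties as Fin using (any?)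
open import Data.Integer.Base as ℤ using (ℤ)
import Data.Integer.Properties as ℤ
open import Data.List.Base as List using (List; []; _∷_; _++_; length; filter; allFin; cartesianProduct; foldr)
import Data.List.Properties as List
open import Data.List.Membership.Propositional using (_∈_)
open import Data.List.Membership.Propositional.Properties using (∈-∃++; ∈-++⁺ˡ; ∈-++⁺ʳ; ∈-++⁻; ∈-cartesianProduct⁺; ∈-filter⁻)
open import Data.List.Relation.Binary.Sublist.Propositional using (_⊆_; []; _∷ʳ_; _∷_)
open import Data.List.Relation.Binary.Sublist.Propositional.Properties using (All-resp-⊆)
open import Data.List.Relation.Unary.All as All using (All; []; _∷_)
open import Data.List.Relation.Unary.AllPairs using ([]; _∷_)
open import Data.List.Relation.Unary.Any using (here; there)
open import Data.List.Relation.Unary.Unique.Propositional using (Unique)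
import Data.List.Relation.Unary.Unique.Propositional.Properties as Unique
open import Data.Nat.Base as ℕ using (ℕ; zero; suc; z≤n; s≤s)
import Data.Nat.Properties as ℕ
open import Data.Product.Base as Product using (∃-syntax; _×_; _,_; proj₁; proj₂; uncurry)
open import Data.Product.Properties using (≡-dec)
open import Data.Rational.Base using (ℚ; 0ℚ; 1ℚ; ½; _+_; _*_; -_; 1/_; _≤_)
open import Data.Rational.Literals using (fromℤ)
open import Data.Rational.Properties as ℚ using (+-*-commutativeRing)
open import Data.Rational.Solver using (module +-*-Solver)
open import Data.Sum.Base using (_⊎_; inj₁; inj₂; swap; [_,_]′; map₂)
open import Data.Vec.Base as Vec using (Vec; []; _∷_; lookup; insertAt; tabulate; _[_]≔_; fromList)
import Data.Vec.Properties as Vec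
open import Function.Base using (_∘_; id)
open import Function.Bundles using (Equivalence)
open import Relation.Binary.Definitions using (tri<; tri≈; tri>)
open import Relation.Binary.PropositionalEquality using (_≡_; _≢_; _≗_; refl; sym; trans; cong; cong₂; subst; module ≡-Reasoning)
open import Relation.Nullary using (Dec; yes; no; does; ¬_; contradiction; ¬?; _⊎-dec_; _×-dec_)
open import Relation.Nullary.Construct.Add.Extrema using (⊤±)
open import Relation.Nullary.Decidable using (dec-true; dec-false; decidable-stable)
open import Relation.Unary using (Decidable)
open CommutativeRing +-*-commutativeRing using (semiring; +-commutativeMonoid; *-commutativeMonoid)
open import Algebra.Properties.CommutativeMonoid.Sum +-commutativeMonoid using (sum; sum-cong-≗; ∑-distrib-+; ∑-comm)
open import Algebra.Properties.CommutativeMonoid.Sum *-commutativeMonoid using () renaming (sum to ∏; sum-cong-≗ to ∏-cong)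
open import Algebra.Properties.Semiring.Sum semiring using (*-distribˡ-sum; *-distribʳ-sum)
open import Algebra.Solver.CommutativeMonoid ∧-commutativeMonoid using (_⊜_) renaming (solve to solveᴮ; _⊕_ to _⊕ᴮ_)
open +-*-Solver using (solve; _:+_; _:*_; :-_; _:=_; con)
open ≡-Reasoning

-- Coefficients counted from the top

-- The difficulty is uniformity in n: `delCon` and the Leibniz sum range over index sets that grow
-- with n, while strong polynomiality controls only sums over tuples of fixed length. For the
-- determinant, Newton's recursion bridges the gap: for fixed r it asks only for closed walks of
-- length at most r, and its division is harmless over ℚ. `edges` lists every edge in both
-- orientations, so the expansion of `delCon` is Whitney's expansion of the graph with all edges
-- doubled. Selecting one orientation would need an order on the vertices, which homomorphism counts
-- cannot see. The sets A therefore consist of ordered pairs, and the bound on |A| is (2r)^2.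
-- Coefficients are kept as sequences on all of ℕ that are 0 beyond the degree. Thus c(r) is a
-- single function of n for each r, also at those n where r exceeds g(n). The degree g(n) is the
-- order of `G n`. Its polynomial is known to take integer values only at natural arguments; a
-- numerical polynomial must do so at all integers, and finite differences supply the rest.

Series : Set
Series = ℕ → ℚ

1ˢ : Series
1ˢ zero    = 1ℚ
1ˢ (suc _) = 0ℚ

shift : Series → Series
shift f zero    = 0ℚ
shift f (suc r) = f r

shift-cong : ∀ {f g} → f ≗ g → shift f ≗ shift g
shift-cong f≗g zero    = refl
shift-cong f≗g (suc r) = f≗g r

shift-neg : ∀ f r → shift (λ s → - f s) r ≡ - shift f r
shift-neg f zero    = refl
shift-neg f (suc r) = refl

-- Multiplication by p + q y.
lin : ℚ × ℚ → Series → Series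
lin (p , q) f r = p * f r + q * shift f r

lin-cong : ∀ a {f g} → f ≗ g → lin a f ≗ lin a g
lin-cong (p , q) f≗g r = cong₂ (λ x y → p * x + q * y) (f≗g r) (shift-cong f≗g r)

lin-comm : ∀ a b f → lin a (lin b f) ≗ lin b (lin a f)
lin-comm (p , q) (p′ , q′) f zero =
  solve 5 (λ p q p′ q′ x → p :* (p′ :* x :+ q′ :* con 0ℚ) :+ q :* con 0ℚ := p′ :* (p :* x :+ q :* con 0ℚ) :+ q′ :* con 0ℚ)
    refl p q p′ q′ (f 0)
lin-comm (p , q) (p′ , q′) f (suc r) =
  solve 7 (λ p q p′ q′ x y z → p :* (p′ :* x :+ q′ :* y) :+ q :* (p′ :* y :+ q′ :* z) :=
                               p′ :* (p :* x :+ q :* y) :+ q′ :* (p :* y :+ q :* z))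
    refl p q p′ q′ (f (suc r)) (f r) (shift f r)

lin-1 : ∀ f → lin (1ℚ , 0ℚ) f ≗ f
lin-1 f r = solve 2 (λ x y → con 1ℚ :* x :+ con 0ℚ :* y := x) refl (f r) (shift f r)

-- p = ∑ f(r) x^(d - r).
record Reversal (d : ℕ) (p : Polynomial) (f : Series) : Set where
  field
    top     : ∀ i r → i ℕ.+ r ≡ d → coeff p i ≡ f r
    vanish  : ∀ r → d ℕ.< r → f r ≡ 0ℚ
    degree≤ : ∀ i → d ℕ.< i → coeff p i ≡ 0ℚ

open Reversal

coeff-⊕ : ∀ p q i → coeff (p ⊕ q) i ≡ coeff p i + coeff q i
coeff-⊕ []      q       i       = sym (ℚ.+-identityˡ _)
coeff-⊕ (a ∷ p) []      i       = sym (ℚ.+-identityʳ _)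
coeff-⊕ (a ∷ p) (b ∷ q) zero    = refl
coeff-⊕ (a ∷ p) (b ∷ q) (suc i) = coeff-⊕ p q i

coeff-neg : ∀ p i → coeff (neg p) i ≡ - coeff p i
coeff-neg []      i       = refl
coeff-neg (a ∷ p) zero    = refl
coeff-neg (a ∷ p) (suc i) = coeff-neg p i

coeff-scale : ∀ a p i → coeff (scale a p) i ≡ a * coeff p i
coeff-scale a []      i       = sym (ℚ.*-zeroʳ a)
coeff-scale a (b ∷ p) zero    = refl
coeff-scale a (b ∷ p) (suc i) = coeff-scale a p i

reversal-cong : ∀ {d p f g} → f ≗ g → Reversal d p f → Reversal d p g
reversal-cong f≗g R .top i r e     = trans (R .top i r e) (f≗g r)
reversal-cong f≗g R .vanish r d<r  = trans (sym (f≗g r)) (R .vanish r d<r)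
reversal-cong f≗g R .degree≤       = R .degree≤

reversal-zero : ∀ {d p} → (∀ i → coeff p i ≡ 0ℚ) → Reversal d p (λ _ → 0ℚ)
reversal-zero z .top i r e    = z i
reversal-zero z .vanish r _   = refl
reversal-zero z .degree≤ i _  = z i

reversal-⊕ : ∀ {d p q f g} → Reversal d p f → Reversal d q g → Reversal d (p ⊕ q) (λ r → f r + g r)
reversal-⊕ {p = p} {q} R S .top i r e    = trans (coeff-⊕ p q i) (cong₂ _+_ (R .top i r e) (S .top i r e))
reversal-⊕ R S .vanish r d<r             = cong₂ _+_ (R .vanish r d<r) (S .vanish r d<r)
reversal-⊕ {p = p} {q} R S .degree≤ i d<i = trans (coeff-⊕ p q i) (cong₂ _+_ (R .degree≤ i d<i) (S .degree≤ i d<i))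

reversal-neg : ∀ {d p f} → Reversal d p f → Reversal d (neg p) (λ r → - f r)
reversal-neg {p = p} R .top i r e     = trans (coeff-neg p i) (cong -_ (R .top i r e))
reversal-neg R .vanish r d<r          = cong -_ (R .vanish r d<r)
reversal-neg {p = p} R .degree≤ i d<i = trans (coeff-neg p i) (cong -_ (R .degree≤ i d<i))

reversal-scale : ∀ a {d p f} → Reversal d p f → Reversal d (scale a p) (λ r → a * f r)
reversal-scale a {p = p} R .top i r e     = trans (coeff-scale a p i) (cong (a *_) (R .top i r e))
reversal-scale a R .vanish r d<r          = trans (cong (a *_) (R .vanish r d<r)) (ℚ.*-zeroʳ a)
reversal-scale a {p = p} R .degree≤ i d<i = trans (coeff-scale a p i) (trans (cong (a *_) (R .degree≤ i d<i)) (ℚ.*-zeroʳ a))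

-- Read against the larger degree, every coefficient lies one place further below the top, which is
-- multiplication by y.
reversal-raise : ∀ {d p f} → Reversal d p f → Reversal (suc d) p (shift f)
reversal-raise R .top i zero e            = R .degree≤ i (ℕ.≤-reflexive (trans (sym e) (ℕ.+-identityʳ i)))
reversal-raise R .top i (suc r) e         = R .top i r (ℕ.suc-injective (trans (sym (ℕ.+-suc i r)) e))
reversal-raise R .vanish (suc r) (s≤s d<r) = R .vanish r d<r
reversal-raise R .degree≤ i d<i           = R .degree≤ i (ℕ.<-trans (ℕ.n<1+n _) d<i)

reversal-X : ∀ {d p f} → Reversal d p f → Reversal (suc d) (0ℚ ∷ p) f
-- Here r = d + 1, so the new constant term 0 is the value of f just beyond the old degree.
reversal-X R .top zero r e               = sym (R .vanish r (ℕ.≤-reflexive (sym e)))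
reversal-X R .top (suc i) r e            = R .top i r (ℕ.suc-injective e)
reversal-X R .vanish r d<r               = R .vanish r (ℕ.<-trans (ℕ.n<1+n _) d<r)
reversal-X R .degree≤ (suc i) (s≤s d<i)  = R .degree≤ i d<i

reversal-1 : Reversal 0 (const 1ℚ) 1ˢ
reversal-1 .top zero zero refl = refl
reversal-1 .vanish (suc r) _   = refl
reversal-1 .degree≤ (suc i) _  = refl

reversal-monomial : ∀ n → Reversal n (monomial n) 1ˢ
reversal-monomial zero    = reversal-1
reversal-monomial (suc n) = reversal-X (reversal-monomial n)

coeff-0∷[] : ∀ i → coeff (0ℚ ∷ []) i ≡ 0ℚ
coeff-0∷[] zero    = refl
coeff-0∷[] (suc i) = refl

-- With y = 1/x one has q + p x = x (p + q y): the factor x goes into the degree, the factor p + q y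
-- into the series.
reversal-linear : ∀ p q {d Q f} → Reversal d Q f → Reversal (suc d) ((q ∷ p ∷ []) ⊗ Q) (lin (p , q) f)
reversal-linear p q {f = f} R = reversal-cong (λ r → eq r)
  (reversal-⊕ (reversal-raise (reversal-scale q R)) (reversal-X (reversal-⊕ (reversal-scale p R) (reversal-zero coeff-0∷[]))))
  where
  eq : ∀ r → shift (λ s → q * f s) r + (p * f r + 0ℚ) ≡ lin (p , q) f r
  eq zero    = solve 3 (λ p q x → con 0ℚ :+ (p :* x :+ con 0ℚ) := p :* x :+ q :* con 0ℚ) refl p q (f 0)
  eq (suc r) = solve 4 (λ p q x y → q :* y :+ (p :* x :+ con 0ℚ) := p :* x :+ q :* y) refl p q (f (suc r)) (f r)

-- Off-diagonal entries of xI - A are constants, yet they have to count as factors of degree one, so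
-- that all Leibniz terms are reversed against the same degree.
reversal-constant : ∀ q {d Q f} → Reversal d Q f → Reversal (suc d) ((q ∷ []) ⊗ Q) (lin (0ℚ , q) f)
reversal-constant q {f = f} R = reversal-cong (λ r → eq r)
  (reversal-⊕ (reversal-raise (reversal-scale q R)) (reversal-zero coeff-0∷[]))
  where
  eq : ∀ r → shift (λ s → q * f s) r + 0ℚ ≡ lin (0ℚ , q) f r
  eq zero    = solve 2 (λ q x → con 0ℚ :+ con 0ℚ := con 0ℚ :* x :+ q :* con 0ℚ) refl q (f 0)
  eq (suc r) = solve 3 (λ q x y → q :* y :+ con 0ℚ := con 0ℚ :* x :+ q :* y) refl q (f (suc r)) (f r)

reversal-coeffBelow : ∀ {d p f} → Reversal d p f → ∀ r → coeffBelow p d r ≡ f r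
reversal-coeffBelow {d} {p} {f} R r with r ℕ.≤? d
... | yes r≤d = trans (cong (if_then coeff p (d ℕ.∸ r) else 0ℚ) (dec-true (r ℕ.≤? d) r≤d)) (R .top (d ℕ.∸ r) r (ℕ.m∸n+n≡m r≤d))
... | no  r≰d = trans (cong (if_then coeff p (d ℕ.∸ r) else 0ℚ) (dec-false (r ℕ.≤? d) r≰d)) (sym (R .vanish r (ℕ.≰⇒> r≰d)))

reversal-degree : ∀ {d p f} → Reversal d p f → f 0 ≢ 0ℚ → HasDegree p d
reversal-degree {d} R f0≢0 = (λ z → f0≢0 (trans (sym (R .top d 0 (ℕ.+-identityʳ d))) z)) , R .degree≤

-- Polynomials in n

eval-scale : ∀ a p x → eval (scale a p) x ≡ a * eval p x
eval-scale a []      x = sym (ℚ.*-zeroʳ a)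
eval-scale a (b ∷ p) x = trans (cong (λ y → a * b + x * y) (eval-scale a p x))
  (solve 4 (λ a b x y → a :* b :+ x :* (a :* y) := a :* (b :+ x :* y)) refl a b x (eval p x))

eval-⊗ : ∀ p q x → eval (p ⊗ q) x ≡ eval p x * eval q x
eval-⊗ []      q x = sym (ℚ.*-zeroˡ (eval q x))
eval-⊗ (a ∷ p) q x = begin
  eval (scale a q ⊕ (0ℚ ∷ p ⊗ q)) x               ≡⟨ eval-⊕ (scale a q) (0ℚ ∷ p ⊗ q) x ⟩
  eval (scale a q) x + (0ℚ + x * eval (p ⊗ q) x)  ≡⟨ cong₂ (λ y z → y + (0ℚ + x * z)) (eval-scale a q x) (eval-⊗ p q x) ⟩
  a * eval q x + (0ℚ + x * (eval p x * eval q x)) ≡⟨ solve 4 (λ a x y z → a :* z :+ (con 0ℚ :+ x :* (y :* z)) := (a :+ x :* y) :* z)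
                                                       refl a x (eval p x) (eval q x) ⟩
  (a + x * eval p x) * eval q x                   ∎

-- Δ(a + x p) = p + Δp + x Δp, and p + Δp + x Δp is no longer than p.
difference : Polynomial → Polynomial
difference []          = []
difference (a ∷ [])    = []
difference (a ∷ p@(_ ∷ _)) = p ⊕ (difference p ⊕ (0ℚ ∷ difference p))

eval-difference : ∀ p x → eval (difference p) x ≡ eval p (1ℚ + x) + - eval p x
eval-difference []       x = refl
eval-difference (a ∷ []) x =
  solve 2 (λ a x → con 0ℚ := a :+ (con 1ℚ :+ x) :* con 0ℚ :+ :- (a :+ x :* con 0ℚ)) refl a x
eval-difference (a ∷ p@(_ ∷ _)) x = begin
  eval (p ⊕ (D ⊕ (0ℚ ∷ D))) x                           ≡⟨ eval-⊕ p (D ⊕ (0ℚ ∷ D)) x ⟩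
  eval p x + eval (D ⊕ (0ℚ ∷ D)) x                      ≡⟨ cong (eval p x +_) (eval-⊕ D (0ℚ ∷ D) x) ⟩
  eval p x + (eval D x + (0ℚ + x * eval D x))           ≡⟨ cong (λ d → eval p x + (d + (0ℚ + x * d))) (eval-difference p x) ⟩
  eval p x + ((y + - eval p x) + (0ℚ + x * (y + - eval p x)))
    ≡⟨ solve 4 (λ a x y z → z :+ ((y :+ :- z) :+ (con 0ℚ :+ x :* (y :+ :- z))) :=
                            a :+ (con 1ℚ :+ x) :* y :+ :- (a :+ x :* z)) refl a x y (eval p x) ⟩
  a + (1ℚ + x) * y + - (a + x * eval p x)               ∎
  where
  D = difference p
  y = eval p (1ℚ + x)

length-⊕ : ∀ p q {l} → length p ℕ.≤ l → length q ℕ.≤ l → length (p ⊕ q) ℕ.≤ l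
length-⊕ []      q       _         q≤       = q≤
length-⊕ (a ∷ p) []      p≤        _        = p≤
length-⊕ (a ∷ p) (b ∷ q) (s≤s p≤) (s≤s q≤) = s≤s (length-⊕ p q p≤ q≤)

length-difference : ∀ a p → length (difference (a ∷ p)) ℕ.≤ length p
length-difference a []      = z≤n
length-difference a p@(b ∷ p′) = length-⊕ p (difference p ⊕ (0ℚ ∷ difference p)) ℕ.≤-refl
  (length-⊕ (difference p) (0ℚ ∷ difference p) (ℕ.≤-trans D≤ (ℕ.n≤1+n _)) (s≤s D≤))
  where
  D≤ = length-difference b p′

fromℤ-+ : ∀ i j → fromℤ i + fromℤ j ≡ fromℤ (i ℤ.+ j)
fromℤ-+ i j = ℚ.toℚᵘ-injective (ℚᵘ.≃-trans (ℚ.toℚᵘ-homo-+ (fromℤ i) (fromℤ j))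
  (*≡* (cong (ℤ._* ℤ.1ℤ) (cong₂ ℤ._+_ (ℤ.*-identityʳ i) (ℤ.*-identityʳ j)))))
  where
  import Data.Rational.Unnormalised.Properties as ℚᵘ
  open import Data.Rational.Unnormalised.Base using (*≡*)

fromℤ-neg : ∀ i → - fromℤ i ≡ fromℤ (ℤ.- i)
fromℤ-neg (ℤ.+ zero)  = refl
fromℤ-neg (ℤ.+ suc n) = refl
fromℤ-neg ℤ.-[1+ n ]  = refl

IsIntegral : ℚ → Set
IsIntegral x = ∃[ z ] x ≡ fromℤ z

integral-sub : ∀ {x y} → IsIntegral x → IsIntegral y → IsIntegral (x + - y)
integral-sub (z , refl) (w , refl) = z ℤ.+ ℤ.- w , trans (cong (fromℤ z +_) (fromℤ-neg w)) (fromℤ-+ z (ℤ.- w))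

-- Induction on a bound for the length. The difference Δp is integral on ℕ, hence on ℤ by induction,
-- and p(x) = p(x + 1) - Δp(x) carries integrality from 0 down through the negative integers.
integral-on-ℕ⇒numerical : ∀ p → (∀ n → IsIntegral (eval p (fromℕ n))) → IsNumerical p
integral-on-ℕ⇒numerical p h = go (length p) p ℕ.≤-refl h
  where
  go : ∀ l p → length p ℕ.≤ l → (∀ n → IsIntegral (eval p (fromℕ n))) → IsNumerical p
  go l       []      _         h q           = ℤ.0ℤ , refl
  go (suc l) (a ∷ p) (s≤s p≤l) h (ℤ.+ n)     = h n
  go (suc l) (a ∷ p) (s≤s p≤l) h ℤ.-[1+ n ]  = descend n
    where
    P = a ∷ p
    Δ-numerical : IsNumerical (difference P)
    Δ-numerical = go l (difference P) (ℕ.≤-trans (length-difference a p) p≤l) λ n →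
      subst IsIntegral (trans (cong (λ x → eval P x + - eval P (fromℕ n)) (fromℕ-suc n)) (sym (eval-difference P (fromℕ n))))
        (integral-sub (h (suc n)) (h n))
    next : ∀ x → IsIntegral (eval P (1ℚ + x)) → IsIntegral (eval (difference P) x) → IsIntegral (eval P x)
    next x i j = subst IsIntegral
      (trans (cong (λ d → eval P (1ℚ + x) + - d) (eval-difference P x))
             (solve 2 (λ y z → y :+ :- (y :+ :- z) := z) refl (eval P (1ℚ + x)) (eval P x)))
      (integral-sub i j)
    descend : ∀ n → IsIntegral (eval P (fromℤ ℤ.-[1+ n ]))
    descend zero    = next _ (subst (IsIntegral ∘ eval P) (sym (fromℤ-+ ℤ.1ℤ ℤ.-1ℤ)) (h 0)) (Δ-numerical ℤ.-1ℤ)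
    descend (suc n) = next _ (subst (IsIntegral ∘ eval P) (sym (fromℤ-+ ℤ.1ℤ ℤ.-[1+ suc n ])) (descend n)) (Δ-numerical ℤ.-[1+ suc n ])

IsPolynomial : (ℕ → ℚ) → Set
IsPolynomial f = ∃[ p ] ∀ n → f n ≡ eval p (fromℕ n)

isPolynomial-cong : ∀ {f g} → f ≗ g → IsPolynomial f → IsPolynomial g
isPolynomial-cong f≗g (p , h) = p , λ n → trans (sym (f≗g n)) (h n)

isPolynomial-const : ∀ a → IsPolynomial (λ _ → a)
isPolynomial-const a = const a , λ n → solve 2 (λ a x → a := a :+ x :* con 0ℚ) refl a (fromℕ n)

isPolynomial-+ : ∀ {f g} → IsPolynomial f → IsPolynomial g → IsPolynomial (λ n → f n + g n)
isPolynomial-+ (p , h) (q , k) = p ⊕ q , λ n → trans (cong₂ _+_ (h n) (k n)) (sym (eval-⊕ p q (fromℕ n)))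

isPolynomial-* : ∀ {f g} → IsPolynomial f → IsPolynomial g → IsPolynomial (λ n → f n * g n)
isPolynomial-* (p , h) (q , k) = p ⊗ q , λ n → trans (cong₂ _*_ (h n) (k n)) (sym (eval-⊗ p q (fromℕ n)))

isPolynomial-divide : ∀ m {f g} → (∀ n → fromℕ (suc m) * f n ≡ g n) → IsPolynomial g → IsPolynomial f
isPolynomial-divide m {f} h g-poly = isPolynomial-cong
  (λ n → trans (cong (1/ fromℕ (suc m) *_) (sym (h n)))
         (trans (sym (ℚ.*-assoc (1/ fromℕ (suc m)) (fromℕ (suc m)) (f n)))
         (trans (cong (_* f n) (ℚ.*-inverseˡ (fromℕ (suc m)))) (ℚ.*-identityˡ (f n)))))
  (isPolynomial-* (isPolynomial-const (1/ fromℕ (suc m))) g-poly)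

fromℕ-injective : ∀ {m n} → fromℕ m ≡ fromℕ n → m ≡ n
fromℕ-injective refl = refl

0≤fromℕ : ∀ n → 0ℚ ≤ fromℕ n
0≤fromℕ n = ℚ.nonNegative⁻¹ (fromℕ n)

-- The polynomial g takes the natural values d n, so S is all of ℕ; the leading coefficient 1 makes
-- the degree exactly d n. For r > d n the coefficient, the series and hence the polynomial for c(r)
-- are all 0 at n.
isTwoLevelOfInfiniteDepth : ∀ (f : ℕ → Polynomial) (c : ℕ → Series) (d : ℕ → ℕ) →
  (∀ n → Reversal (d n) (f n) (c n)) → (∀ n → c n 0 ≡ 1ℚ) →
  IsPolynomial (fromℕ ∘ d) → (∀ r → IsPolynomial (λ n → c n r)) →
  IsTwoLevelPolynomialOfInfiniteDepth f
isTwoLevelOfInfiniteDepth f c d R monic (g , g-eq) c-poly = g , (λ _ → ⊤±) , record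
  { numerical             = integral-on-ℕ⇒numerical g λ n → ℤ.+ d n , sym (g-eq n)
  ; eventuallyNonnegative = 0 , λ n _ → in-S n
  ; degree                = λ q d′ e → subst (HasDegree (f q)) (degree-unique q e)
                              (reversal-degree (R q) (λ z → contradiction (trans (sym (monic q)) z) (λ ())))
  ; coefficients          = (λ r → proj₁ (c-poly r)) , λ q d′ e r _ →
                              trans (cong (λ m → coeffBelow (f q) m r) (sym (degree-unique q e)))
                              (trans (reversal-coeffBelow (R q) r) (proj₂ (c-poly r) q))
  ; off-S-zero            = λ q q∉S → contradiction (in-S q) q∉S
  ; off-S-depth           = λ q q∉S → contradiction (in-S q) q∉S
  } , λ _ _ → refl
  where
  in-S : ∀ n → n ∈S[ g ]
  in-S n = subst (0ℚ ≤_) (g-eq n) (0≤fromℕ (d n))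
  degree-unique : ∀ q {d′} → eval g (fromℕ q) ≡ fromℕ d′ → d q ≡ d′
  degree-unique q e = fromℕ-injective (trans (g-eq q) e)

-- Sums over tuples of vertices

∑ᵛ-* : ∀ k {m} a (f : Vec (Fin m) k → ℚ) → ∑ᵛ k (λ u → a * f u) ≡ a * ∑ᵛ k f
∑ᵛ-* zero    a f = refl
∑ᵛ-* (suc k) a f = trans (sum-cong-≗ λ x → ∑ᵛ-* k a (f ∘ (x ∷_))) (sym (*-distribˡ-sum a (λ x → ∑ᵛ k (f ∘ (x ∷_)))))

[_]ᴮ : Bool → ℚ
[ b ]ᴮ = if b then 1ℚ else 0ℚ

[]ᴮ-≡0 : ∀ b → ¬ T b → [ b ]ᴮ ≡ 0ℚ
[]ᴮ-≡0 true  ¬b = contradiction _ ¬b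
[]ᴮ-≡0 false ¬b = refl

[]ᴮ-≡1 : ∀ b → T b → [ b ]ᴮ ≡ 1ℚ
[]ᴮ-≡1 true _ = refl

if-[]ᴮ : ∀ b x y → (if b then x else y) ≡ [ b ]ᴮ * x + (1ℚ + - [ b ]ᴮ) * y
if-[]ᴮ true  x y = solve 2 (λ x y → x := con 1ℚ :* x :+ con 0ℚ :* y) refl x y
if-[]ᴮ false x y = solve 2 (λ x y → y := con 0ℚ :* x :+ con 1ℚ :* y) refl x y

edgeWeight : ∀ (G : Graph) {k} → List (Fin k × Fin k) → Vec (Fin (order G)) k → ℚ
edgeWeight G []            u = 1ℚ
edgeWeight G ((i , j) ∷ C) u = adjacencyMatrix G (lookup u i) (lookup u j) * edgeWeight G C u

-- A product of Kronecker deltas, in the `if` form that `∑ᵛ-contract` eliminates.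
equalityWeight : ∀ {m k} → List (Fin k × Fin k) → Vec (Fin m) k → ℚ
equalityWeight []            u = 1ℚ
equalityWeight ((i , j) ∷ D) u = if does (lookup u i Fin.≟ lookup u j) then equalityWeight D u else 0ℚ

module _ {n} {i j : Fin (suc n)} (j≢i : j ≢ i) where

  mergePairs : List (Fin (suc n) × Fin (suc n)) → List (Fin n × Fin n)
  mergePairs = List.map (Product.map (merge j≢i) (merge j≢i))

  edgeWeight-merge : ∀ (G : Graph) (C : List (Fin (suc n) × Fin (suc n))) (c : Vec (Fin (order G)) n) →
    edgeWeight G C (insertAt c j (lookup c (punchOut j≢i))) ≡ edgeWeight G (mergePairs C) c
  edgeWeight-merge G []            c = refl
  edgeWeight-merge G ((u , v) ∷ C) c
    rewrite lookup-merge j≢i c u | lookup-merge j≢i c v | edgeWeight-merge G C c = refl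

  equalityWeight-merge : ∀ {m} D (c : Vec (Fin m) n) →
    equalityWeight D (insertAt c j (lookup c (punchOut j≢i))) ≡ equalityWeight (mergePairs D) c
  equalityWeight-merge []            c = refl
  equalityWeight-merge ((u , v) ∷ D) c
    rewrite lookup-merge j≢i c u | lookup-merge j≢i c v | equalityWeight-merge D c = refl

edgeWeight-view : ∀ G {k} (C : List (Fin k × Fin k)) u →
  (edgeWeight G C u ≡ 1ℚ × All (λ (i , j) → T (adj G (lookup u i) (lookup u j))) C) ⊎
  (edgeWeight G C u ≡ 0ℚ × ∃[ i ] ∃[ j ] (i , j) ∈ C × ¬ T (adj G (lookup u i) (lookup u j)))
edgeWeight-view G []            u = inj₁ (refl , [])
edgeWeight-view G ((i , j) ∷ C) u with adj G (lookup u i) (lookup u j) in eq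
... | false = inj₂ (ℚ.*-zeroˡ (edgeWeight G C u) , i , j , here refl , subst T eq)
... | true with edgeWeight-view G C u
...   | inj₁ (w , all)                = inj₁ (trans (ℚ.*-identityˡ _) w , subst T (sym eq) _ ∷ all)
...   | inj₂ (w , i′ , j′ , ∈C , ¬a)  = inj₂ (trans (ℚ.*-identityˡ _) w , i′ , j′ , there ∈C , ¬a)

T-does⇒ : ∀ {A : Set} (a? : Dec A) → T (does a?) → A
T-does⇒ (yes a) _ = a

⇒T-does : ∀ {A : Set} (a? : Dec A) → A → T (does a?)
⇒T-does a? a = subst T (sym (dec-true a? a)) _

module _ {k} (C : List (Fin k × Fin k)) (loopless : ∀ i → ¬ (i , i) ∈ C) where

  open import Data.List.Membership.DecPropositional {A = Fin k × Fin k} (≡-dec Fin._≟_ Fin._≟_) using (_∈?_)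

  joined? : ∀ i j → Dec ((i , j) ∈ C ⊎ (j , i) ∈ C)
  joined? i j = (i , j) ∈? C ⊎-dec (j , i) ∈? C

  patternGraph : Graph
  patternGraph = record
    { order  = k
    ; adj    = λ i j → does (joined? i j)
    ; symm   = λ i j t → ⇒T-does (joined? j i) (swap (T-does⇒ (joined? i j) t))
    ; irrefl = λ i t → [ loopless i , loopless i ]′ (T-does⇒ (joined? i i) t)
    }

  -- The pattern graph forgets multiplicities and orientations of the pairs in `C`. The weight does
  -- not see them either: adjacency indicators of `H` are idempotent and symmetric.
  hom-patternGraph : ∀ H → fromℕ (hom patternGraph H) ≡ ∑ᵛ k (edgeWeight H C)
  hom-patternGraph H =
    trans (length-filter (isHom? patternGraph H) (maps k (order H)))
    (trans (∑ˡ-maps k (order H) _) (∑ᵛ-cong k indicator))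
    where
    indicator : ∀ u → (if does (isHom? patternGraph H u) then 1ℚ else 0ℚ) ≡ edgeWeight H C u
    indicator u with edgeWeight-view H C u
    ... | inj₁ (w , all) = trans (indicator-yes (isHom? patternGraph H u) isHom) (sym w)
      where
      isHom : IsHom patternGraph H u
      isHom i j t with T-does⇒ (joined? i j) t
      ... | inj₁ ij∈C = All.lookup all ij∈C
      ... | inj₂ ji∈C = symm H _ _ (All.lookup all ji∈C)
    ... | inj₂ (w , i , j , ij∈C , ¬a) = trans
      (indicator-no (isHom? patternGraph H u) λ h → ¬a (h i j (⇒T-does (joined? i j) (inj₁ ij∈C)))) (sym w)

edgeWeight-loop : ∀ G {k} (C : List (Fin k × Fin k)) {i} → (i , i) ∈ C → ∀ u → edgeWeight G C u ≡ 0ℚ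
edgeWeight-loop G C {i} ii∈C u with edgeWeight-view G C u
... | inj₁ (_ , all) = contradiction (All.lookup all ii∈C) (irrefl G (lookup u i))
... | inj₂ (w , _)   = w

-- Definable weights along a strongly polynomial sequence

module Counting (G : ℕ → Graph) (G-poly : StronglyPolynomial G) where

  -- A list with a loop is no pattern of a simple graph, but then the weight is 0 because `G n` is
  -- irreflexive. All other lists give homomorphism counts.
  edgeWeight-isPolynomial : ∀ k (C : List (Fin k × Fin k)) → IsPolynomial (λ n → ∑ᵛ k (edgeWeight (G n) C))
  edgeWeight-isPolynomial k C with any? (λ i → (i , i) ∈? C)
    where open import Data.List.Membership.DecPropositional {A = Fin k × Fin k} (≡-dec Fin._≟_ Fin._≟_) using (_∈?_)
  ... | yes (i , ii∈C) = isPolynomial-cong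
    (λ n → sym (trans (∑ᵛ-cong k (edgeWeight-loop (G n) C ii∈C)) (∑ᵛ-zero k))) (isPolynomial-const 0ℚ)
  ... | no loopless = isPolynomial-cong (λ n → hom-patternGraph C (λ i ii∈C → loopless (i , ii∈C)) (G n))
    (G-poly (patternGraph C λ i ii∈C → loopless (i , ii∈C)))

  WeightIsPolynomial : ∀ k → List (Fin k × Fin k) → List (Fin k × Fin k) → Set
  WeightIsPolynomial k C D = IsPolynomial (λ n → ∑ᵛ k (λ u → equalityWeight D u * edgeWeight (G n) C u))

  -- For i = j the condition is vacuous. Otherwise it eliminates entry j of the tuple and renames
  -- the pairs by `merge`, which is why the result is assumed for all lists over k: the induction is
  -- on k first and on the length of `D` second.
  equality-isPolynomial : ∀ {k} (C D : List (Fin (suc k) × Fin (suc k))) i j → WeightIsPolynomial (suc k) C D →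
    (∀ C D → WeightIsPolynomial k C D) → WeightIsPolynomial (suc k) C ((i , j) ∷ D)
  equality-isPolynomial {k} C D i j deleted contracted with j Fin.≟ i
  ... | yes refl = isPolynomial-cong
    (λ n → ∑ᵛ-cong (suc k) λ u → cong (λ b → (if b then equalityWeight D u else 0ℚ) * edgeWeight (G n) C u)
      (sym (dec-true (lookup u i Fin.≟ lookup u i) refl)))
    deleted
  ... | no j≢i = isPolynomial-cong
    (λ n → sym (trans (∑ᵛ-cong (suc k) (λ u → if-* (does (lookup u i Fin.≟ lookup u j)) (equalityWeight D u) (edgeWeight (G n) C u)))
      (trans (∑ᵛ-contract j≢i (λ u → equalityWeight D u * edgeWeight (G n) C u))
        (∑ᵛ-cong k λ c → cong₂ _*_ (equalityWeight-merge j≢i D c) (edgeWeight-merge j≢i (G n) C c)))))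
    (contracted (mergePairs j≢i C) (mergePairs j≢i D))
    where
    if-* : ∀ b x y → (if b then x else 0ℚ) * y ≡ (if b then x * y else 0ℚ)
    if-* true  x y = refl
    if-* false x y = ℚ.*-zeroˡ y

  weight-isPolynomial : ∀ k C D → WeightIsPolynomial k C D
  weight-isPolynomial k       C []            = isPolynomial-cong (λ n → ∑ᵛ-cong k λ u → sym (ℚ.*-identityˡ _)) (edgeWeight-isPolynomial k C)
  weight-isPolynomial (suc k) C ((i , j) ∷ D) = equality-isPolynomial C D i j (weight-isPolynomial (suc k) C D) (weight-isPolynomial k)

  Weight : ℕ → Set
  Weight k = ∀ n → Vec (Fin (order (G n))) k → ℚ

  BoolFamily : ℕ → Set
  BoolFamily k = ∀ n → Vec (Fin (order (G n))) k → Bool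

  infixl 7 _·_
  _·_ : ∀ {k} → Weight k → Weight k → Weight k
  (φ · ψ) n u = φ n u * ψ n u

  -- The quantification over `C` and `D` makes the notion stable under a further adjacency or
  -- equality indicator, which only lengthens one of the lists.
  Countable : ∀ {k} → Weight k → Set
  Countable {k} w = ∀ C D → IsPolynomial (λ n → ∑ᵛ k (λ u → w n u * (equalityWeight D u * edgeWeight (G n) C u)))

  countable-cong : ∀ {k} {w w′ : Weight k} → (∀ n u → w n u ≡ w′ n u) → Countable w → Countable w′
  countable-cong {k} eq cw C D = isPolynomial-cong (λ n → ∑ᵛ-cong k λ u → cong (_* _) (eq n u)) (cw C D)

  -- Multipliers of countable weights form an algebra, so that no normal form
  -- of products of sums is needed.
  record Definable {k} (φ : Weight k) : Set where
    field absorb : ∀ w → Countable w → Countable (φ · w)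

  open Definable

  definable-cong : ∀ {k} {φ ψ : Weight k} → (∀ n u → φ n u ≡ ψ n u) → Definable φ → Definable ψ
  definable-cong eq dφ .absorb w cw = countable-cong (λ n u → cong (_* w n u) (eq n u)) (dφ .absorb w cw)

  definable-const : ∀ {k} a → Definable {k} (λ _ _ → a)
  definable-const {k} a .absorb w cw C D = isPolynomial-cong
    (λ n → trans (sym (∑ᵛ-* k a _)) (∑ᵛ-cong k λ u → sym (ℚ.*-assoc a (w n u) _)))
    (isPolynomial-* (isPolynomial-const a) (cw C D))

  definable-+ : ∀ {k} {φ ψ : Weight k} → Definable φ → Definable ψ → Definable (λ n u → φ n u + ψ n u)
  definable-+ {k} {φ} {ψ} dφ dψ .absorb w cw C D = isPolynomial-cong
    (λ n → trans (sym (∑ᵛ-+ k (λ u → φ n u * w n u * (equalityWeight D u * edgeWeight (G n) C u)) (λ u → ψ n u * w n u * (equalityWeight D u * edgeWeight (G n) C u)))) (∑ᵛ-cong k λ u →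
      solve 4 (λ a b x y → (a :* x) :* y :+ (b :* x) :* y := (a :+ b) :* x :* y) refl (φ n u) (ψ n u) (w n u) _))
    (isPolynomial-+ (dφ .absorb w cw C D) (dψ .absorb w cw C D))

  definable-* : ∀ {k} {φ ψ : Weight k} → Definable φ → Definable ψ → Definable (φ · ψ)
  definable-* {k} {φ} {ψ} dφ dψ .absorb w cw = countable-cong (λ n u → sym (ℚ.*-assoc (φ n u) (ψ n u) (w n u)))
    (dφ .absorb (ψ · w) (dψ .absorb w cw))

  definable-neg : ∀ {k} {φ : Weight k} → Definable φ → Definable (λ n u → - φ n u)
  definable-neg {φ = φ} dφ = definable-cong
    (λ n u → solve 1 (λ x → con (- 1ℚ) :* x := :- x) refl (φ n u)) (definable-* (definable-const (- 1ℚ)) dφ)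

  definable-edge : ∀ {k} (i j : Fin k) → Definable (λ n u → adjacencyMatrix (G n) (lookup u i) (lookup u j))
  definable-edge {k} i j .absorb w cw C D = isPolynomial-cong
    (λ n → ∑ᵛ-cong k λ u → solve 4 (λ a w x y → w :* (x :* (a :* y)) := (a :* w) :* (x :* y)) refl
      (adjacencyMatrix (G n) (lookup u i) (lookup u j)) (w n u) (equalityWeight D u) (edgeWeight (G n) C u))
    (cw ((i , j) ∷ C) D)

  record DefinableBool {k} (b : BoolFamily k) : Set where
    field indicator : Definable (λ n u → [ b n u ]ᴮ)

  open DefinableBool

  definable-equality : ∀ {k} (i j : Fin k) → DefinableBool (λ n u → does (lookup u i Fin.≟ lookup u j))
  definable-equality {k} i j .indicator .absorb w cw C D = isPolynomial-cong
    (λ n → ∑ᵛ-cong k λ u → eq (does (lookup u i Fin.≟ lookup u j)) (w n u) (equalityWeight D u) (edgeWeight (G n) C u))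
    (cw C ((i , j) ∷ D))
    where
    eq : ∀ b w x y → w * ((if b then x else 0ℚ) * y) ≡ [ b ]ᴮ * w * (x * y)
    eq true  w x y = solve 3 (λ w x y → w :* (x :* y) := con 1ℚ :* w :* (x :* y)) refl w x y
    eq false w x y = solve 3 (λ w x y → w :* (con 0ℚ :* y) := con 0ℚ :* w :* (x :* y)) refl w x y

  definable-∧ : ∀ {k} {b c : BoolFamily k} →
                DefinableBool b → DefinableBool c → DefinableBool (λ n u → b n u ∧ c n u)
  definable-∧ {b = b} {c} db dc .indicator = definable-cong (λ n u → eq (b n u) (c n u)) (definable-* (db .indicator) (dc .indicator))
    where
    eq : ∀ b c → [ b ]ᴮ * [ c ]ᴮ ≡ [ b ∧ c ]ᴮ
    eq true  c = ℚ.*-identityˡ _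
    eq false c = ℚ.*-zeroˡ [ c ]ᴮ

  definable-if : ∀ {k} {b : BoolFamily k} {φ ψ : Weight k} →
                 DefinableBool b → Definable φ → Definable ψ → Definable (λ n u → if b n u then φ n u else ψ n u)
  definable-if {b = b} {φ} {ψ} db dφ dψ = definable-cong (λ n u → sym (if-[]ᴮ (b n u) (φ n u) (ψ n u)))
    (definable-+ (definable-* (db .indicator) dφ) (definable-* (definable-+ (definable-const 1ℚ) (definable-neg (db .indicator))) dψ))

  definable-not : ∀ {k} {b : BoolFamily k} → DefinableBool b → DefinableBool (λ n u → not (b n u))
  definable-not {b = b} db .indicator = definable-cong (λ n u → eq (b n u)) (definable-+ (definable-const 1ℚ) (definable-neg (db .indicator)))
    where
    eq : ∀ b → 1ℚ + - [ b ]ᴮ ≡ [ not b ]ᴮ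
    eq true  = refl
    eq false = refl

  definable-∨ : ∀ {k} {b c : BoolFamily k} →
                DefinableBool b → DefinableBool c → DefinableBool (λ n u → b n u ∨ c n u)
  definable-∨ {b = b} {c} db dc .indicator = definable-cong (λ n u → eq (b n u) (c n u)) (definable-if db (definable-const 1ℚ) (dc .indicator))
    where
    eq : ∀ b c → (if b then 1ℚ else [ c ]ᴮ) ≡ [ b ∨ c ]ᴮ
    eq true  c = refl
    eq false c = refl

  definable⇒isPolynomial : ∀ {k} {φ : Weight k} → Definable φ → IsPolynomial (λ n → ∑ᵛ k (φ n))
  definable⇒isPolynomial {k} {φ} dφ = isPolynomial-cong
    (λ n → ∑ᵛ-cong k λ u → solve 1 (λ x → (x :* con 1ℚ) :* (con 1ℚ :* con 1ℚ) := x) refl (φ n u))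
    (dφ .absorb (λ _ _ → 1ℚ) (λ C D → isPolynomial-cong (λ n → ∑ᵛ-cong k λ u → sym (ℚ.*-identityˡ _)) (weight-isPolynomial k C D)) [] [])

  order-isPolynomial : IsPolynomial (λ n → fromℕ (order (G n)))
  order-isPolynomial = isPolynomial-cong (λ n → ∑-one (order (G n))) (definable⇒isPolynomial (definable-const {1} 1ℚ))

-- Alternating functions and determinants

x≡-x⇒x≡0 : ∀ {x} → x ≡ - x → x ≡ 0ℚ
x≡-x⇒x≡0 {x} e = trans (solve 1 (λ x → x := con ½ :* (x :+ x)) refl x)
  (trans (cong (λ y → ½ * (x + y)) e) (solve 1 (λ x → con ½ :* (x :+ :- x) := con 0ℚ) refl x))

swapAt : ∀ {A : Set} {k} → Fin k → Vec A (suc k) → Vec A (suc k)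
swapAt zero    (a ∷ b ∷ v) = b ∷ a ∷ v
swapAt (suc i) (a ∷ v)     = a ∷ swapAt i v

Alternating : ∀ {A : Set} {k} → (Vec A (suc k) → ℚ) → Set
Alternating f = ∀ i v → f (swapAt i v) ≡ - f v

-- Adjacent swaps move `a` along the tuple until it meets its copy; swapping equal neighbours gives
-- x = -x, hence x = 0 over ℚ.
alternating-head : ∀ {A : Set} {k} (f : Vec A (suc k) → ℚ) → Alternating f → ∀ a v j →
                   lookup v j ≡ a → f (a ∷ v) ≡ 0ℚ
alternating-head f alt a (b ∷ v) zero    refl = x≡-x⇒x≡0 (alt zero (b ∷ b ∷ v))
alternating-head f alt a (b ∷ v) (suc j) e    = begin
  f (a ∷ b ∷ v)   ≡⟨ alt zero (b ∷ a ∷ v) ⟩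
  - f (b ∷ a ∷ v) ≡⟨ cong -_ (alternating-head (f ∘ (b ∷_)) (λ i → alt (suc i) ∘ (b ∷_)) a v j e) ⟩
  0ℚ              ∎

alternating-repeat : ∀ {A : Set} {k} (f : Vec A (suc k) → ℚ) → Alternating f → ∀ v i j →
                     i ≢ j → lookup v i ≡ lookup v j → f v ≡ 0ℚ
alternating-repeat f alt v       zero    zero    i≢j e = contradiction refl i≢j
alternating-repeat f alt (a ∷ v) zero    (suc j) i≢j e = alternating-head f alt a v j (sym e)
alternating-repeat f alt (a ∷ v) (suc i) zero    i≢j e = alternating-head f alt a v i e
alternating-repeat f alt (a ∷ v@(_ ∷ _)) (suc i) (suc j) i≢j e =
  alternating-repeat (f ∘ (a ∷_)) (λ l → alt (suc l) ∘ (a ∷_)) v i j (i≢j ∘ cong suc) e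

-- The Levi-Civita symbol ε v = ∏_{i<j} sgn (v j - v i).
flip : Bool → ℚ
flip b = if b then - 1ℚ else 1ℚ

-- The value 0 on equal arguments makes `ε` vanish on tuples with a repetition, so that sums over
-- permutations become sums `∑ᵛ` over all tuples.
sgn : ∀ {n} → Fin n → Fin n → ℚ
sgn a b = if does (a Fin.≟ b) then 0ℚ else flip (does (b Fin.<? a))

signs : ∀ {n k} → Fin n → Vec (Fin n) k → ℚ
signs a []      = 1ℚ
signs a (b ∷ v) = sgn a b * signs a v

ε : ∀ {n k} → Vec (Fin n) k → ℚ
ε []      = 1ℚ
ε (a ∷ v) = signs a v * ε v

sgn-antisym : ∀ {n} (a b : Fin n) → sgn b a ≡ - sgn a b
sgn-antisym a b with Fin.<-cmp a b
... | tri≈ _ refl _ rewrite dec-true (a Fin.≟ a) refl = refl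
... | tri< a<b a≢b b≮a
  rewrite dec-false (a Fin.≟ b) a≢b | dec-false (b Fin.≟ a) (a≢b ∘ sym) | dec-true (a Fin.<? b) a<b | dec-false (b Fin.<? a) b≮a = refl
... | tri> a≮b a≢b b<a
  rewrite dec-false (a Fin.≟ b) a≢b | dec-false (b Fin.≟ a) (a≢b ∘ sym) | dec-true (b Fin.<? a) b<a | dec-false (a Fin.<? b) a≮b = refl

signs-swapAt : ∀ {n k} (a : Fin n) i (v : Vec (Fin n) (suc k)) → signs a (swapAt i v) ≡ signs a v
signs-swapAt a zero    (b ∷ c ∷ v) = solve 3 (λ x y z → y :* (x :* z) := x :* (y :* z)) refl (sgn a b) (sgn a c) (signs a v)
signs-swapAt a (suc i) (b ∷ v)     = cong (sgn a b *_) (signs-swapAt a i v)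

ε-alternating : ∀ {n k} → Alternating {k = k} (ε {n})
ε-alternating zero (a ∷ b ∷ v) = begin
  sgn b a * signs b v * (signs a v * ε v)     ≡⟨ cong (λ s → s * signs b v * (signs a v * ε v)) (sgn-antisym a b) ⟩
  (- sgn a b) * signs b v * (signs a v * ε v) ≡⟨ solve 4 (λ s x y z → (:- s) :* y :* (x :* z) := :- (s :* x :* (y :* z))) refl
                                                   (sgn a b) (signs a v) (signs b v) (ε v) ⟩
  - (sgn a b * signs a v * (signs b v * ε v)) ∎
ε-alternating (suc i) (a ∷ v@(_ ∷ _)) = begin
  signs a (swapAt i v) * ε (swapAt i v) ≡⟨ cong₂ _*_ (signs-swapAt a i v) (ε-alternating i v) ⟩
  signs a v * - ε v                     ≡⟨ ℚ.neg-distribʳ-* (signs a v) (ε v) ⟨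
  - (signs a v * ε v)                   ∎

∑ᵛ-swapAt : ∀ k {m} i (f : Vec (Fin m) (suc k) → ℚ) → ∑ᵛ (suc k) (f ∘ swapAt i) ≡ ∑ᵛ (suc k) f
∑ᵛ-swapAt (suc k) zero    f = ∑-comm (λ a b → ∑ᵛ k (λ v → f (b ∷ a ∷ v)))
∑ᵛ-swapAt (suc k) (suc i) f = sum-cong-≗ λ a → ∑ᵛ-swapAt k i (f ∘ (a ∷_))

-- An entry (p , q) stands for p + q y.
Row : ℕ → Set
Row n = Fin n → ℚ × ℚ

rowProduct : ∀ {n k} → Vec (Row n) k → Vec (Fin n) k → Series
rowProduct []         []      = 1ˢ
rowProduct (ρ ∷ rows) (j ∷ σ) = lin (ρ j) (rowProduct rows σ)

determinant : ∀ {n k} → Vec (Row n) k → Series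
determinant {n} {k} rows r = ∑ᵛ k (λ σ → ε σ * rowProduct rows σ r)

rowProduct-swapAt : ∀ {n k} i (rows : Vec (Row n) (suc k)) σ →
                    rowProduct (swapAt i rows) (swapAt i σ) ≗ rowProduct rows σ
rowProduct-swapAt zero    (ρ ∷ ρ′ ∷ rows) (j ∷ j′ ∷ σ) = lin-comm (ρ′ j′) (ρ j) (rowProduct rows σ)
rowProduct-swapAt (suc i) (ρ ∷ rows)      (j ∷ σ)      = lin-cong (ρ j) (rowProduct-swapAt i rows σ)

determinant-alternating : ∀ {n k} r → Alternating {k = k} (λ rows → determinant {n} rows r)
determinant-alternating {k = k} r i rows = begin
  ∑ᵛ (suc k) (λ σ → ε σ * rowProduct (swapAt i rows) σ r)
    ≡⟨ ∑ᵛ-swapAt k i (λ σ → ε σ * rowProduct (swapAt i rows) σ r) ⟨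
  ∑ᵛ (suc k) (λ σ → ε (swapAt i σ) * rowProduct (swapAt i rows) (swapAt i σ) r)
    ≡⟨ ∑ᵛ-cong (suc k) (λ σ → cong₂ _*_ (ε-alternating i σ) (rowProduct-swapAt i rows σ r)) ⟩
  ∑ᵛ (suc k) (λ σ → (- ε σ) * rowProduct rows σ r)
    ≡⟨ ∑ᵛ-cong (suc k) (λ σ → ℚ.neg-distribˡ-* (ε σ) (rowProduct rows σ r)) ⟨
  ∑ᵛ (suc k) (λ σ → - (ε σ * rowProduct rows σ r))
    ≡⟨ ∑ᵛ-neg (suc k) (λ σ → ε σ * rowProduct rows σ r) ⟩
  - determinant rows r ∎

-- Putting this row in place of row i drops the factor of row i from every row product and keeps the
-- number of rows.
one : ∀ {n} → Row n
one _ = 1ℚ , 0ℚ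

rowProduct-update : ∀ {n k} (rows : Vec (Row n) k) i ρ σ →
  rowProduct (rows [ i ]≔ ρ) σ ≗ lin (ρ (lookup σ i)) (rowProduct (rows [ i ]≔ one) σ)
rowProduct-update (_ ∷ rows) zero    ρ (j ∷ σ) r = lin-cong (ρ j) (λ s → sym (lin-1 (rowProduct rows σ) s)) r
rowProduct-update (ρ′ ∷ rows) (suc i) ρ (j ∷ σ) r =
  trans (lin-cong (ρ′ j) (rowProduct-update rows i ρ σ) r) (lin-comm (ρ′ j) (ρ (lookup σ i)) _ r)

-- For a square matrix, entry (j, i) of the adjugate, written without deleting a row or a column.
cofactor : ∀ {n k} → Vec (Row n) k → Fin k → Fin n → Series
cofactor {k = k} rows i j r = ∑ᵛ k (λ σ → ε σ * ([ does (lookup σ i Fin.≟ j) ]ᴮ * rowProduct (rows [ i ]≔ one) σ r))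

lin-∑ᵛ : ∀ a k {m} (F : Vec (Fin m) k → Series) r → lin a (λ s → ∑ᵛ k (λ σ → F σ s)) r ≡ ∑ᵛ k (λ σ → lin a (F σ) r)
lin-∑ᵛ (p , q) k F zero = begin
  p * ∑ᵛ k (λ σ → F σ 0) + q * 0ℚ     ≡⟨ solve 3 (λ p q x → p :* x :+ q :* con 0ℚ := p :* x) refl p q (∑ᵛ k (λ σ → F σ 0)) ⟩
  p * ∑ᵛ k (λ σ → F σ 0)              ≡⟨ ∑ᵛ-* k p (λ σ → F σ 0) ⟨
  ∑ᵛ k (λ σ → p * F σ 0)              ≡⟨ ∑ᵛ-cong k (λ σ → solve 3 (λ p q x → p :* x := p :* x :+ q :* con 0ℚ) refl p q (F σ 0)) ⟩
  ∑ᵛ k (λ σ → p * F σ 0 + q * 0ℚ)     ∎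
lin-∑ᵛ (p , q) k F (suc r) = sym (trans (∑ᵛ-+ k (λ σ → p * F σ (suc r)) (λ σ → q * F σ r))
  (cong₂ _+_ (∑ᵛ-* k p (λ σ → F σ (suc r))) (∑ᵛ-* k q (λ σ → F σ r))))

lin-scale : ∀ a c f r → lin a (λ s → c * f s) r ≡ c * lin a f r
lin-scale (p , q) c f zero    = solve 4 (λ p q c x → p :* (c :* x) :+ q :* con 0ℚ := c :* (p :* x :+ q :* con 0ℚ)) refl p q c (f 0)
lin-scale (p , q) c f (suc r) = solve 5 (λ p q c x y → p :* (c :* x) :+ q :* (c :* y) := c :* (p :* x :+ q :* y)) refl p q c (f (suc r)) (f r)

∑-delta : ∀ {m} (x : Fin m) (f : Fin m → ℚ) → sum (λ a → [ does (x Fin.≟ a) ]ᴮ * f a) ≡ f x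
∑-delta x f = trans (sum-cong-≗ λ a → eq (does (x Fin.≟ a)) (f a)) (∑-point x f)
  where
  eq : ∀ b y → [ b ]ᴮ * y ≡ (if b then y else 0ℚ)
  eq true  y = ℚ.*-identityˡ y
  eq false y = ℚ.*-zeroˡ y

-- Laplace expansion along row i. The cofactors do not depend on that row, so the same ones serve
-- for every ρ placed there.
determinant-expand : ∀ {n k} (rows : Vec (Row n) k) i ρ r →
  determinant (rows [ i ]≔ ρ) r ≡ sum (λ j → lin (ρ j) (cofactor rows i j) r)
determinant-expand {n} {k} rows i ρ r = sym (begin
  sum (λ j → lin (ρ j) (cofactor rows i j) r)
    ≡⟨ sum-cong-≗ (λ j → trans (lin-∑ᵛ (ρ j) k (λ σ s → ε σ * (δ σ j * rest σ s)) r)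
         (∑ᵛ-cong k λ σ → trans (lin-scale (ρ j) (ε σ) (λ s → δ σ j * rest σ s) r) (cong (ε σ *_) (lin-scale (ρ j) (δ σ j) (rest σ) r)))) ⟩
  sum (λ j → ∑ᵛ k (λ σ → ε σ * (δ σ j * lin (ρ j) (rest σ) r)))
    ≡⟨ ∑ᵛ-∑ k (λ j σ → ε σ * (δ σ j * lin (ρ j) (rest σ) r)) ⟩
  ∑ᵛ k (λ σ → sum (λ j → ε σ * (δ σ j * lin (ρ j) (rest σ) r)))
    ≡⟨ ∑ᵛ-cong k (λ σ → trans (sym (*-distribˡ-sum (ε σ) (λ j → δ σ j * lin (ρ j) (rest σ) r)))
         (cong (ε σ *_) (∑-delta (lookup σ i) (λ j → lin (ρ j) (rest σ) r)))) ⟩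
  ∑ᵛ k (λ σ → ε σ * lin (ρ (lookup σ i)) (rest σ) r)
    ≡⟨ ∑ᵛ-cong k (λ σ → cong (ε σ *_) (rowProduct-update rows i ρ σ r)) ⟨
  determinant (rows [ i ]≔ ρ) r ∎)
  where
  δ : Vec (Fin n) k → Fin n → ℚ
  δ σ j = [ does (lookup σ i Fin.≟ j) ]ᴮ
  rest : Vec (Fin n) k → Series
  rest = rowProduct (rows [ i ]≔ one)

lin-sum : ∀ a {m} (F : Fin m → Series) r → lin a (λ s → sum (λ i → F i s)) r ≡ sum (λ i → lin a (F i) r)
lin-sum a {zero} F zero    = solve 2 (λ p q → p :* con 0ℚ :+ q :* con 0ℚ := con 0ℚ) refl (proj₁ a) (proj₂ a)
lin-sum a {zero} F (suc r) = solve 2 (λ p q → p :* con 0ℚ :+ q :* con 0ℚ := con 0ℚ) refl (proj₁ a) (proj₂ a)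
lin-sum a {suc m} F r = trans (lin-+ r) (cong (lin a (F zero) r +_) (lin-sum a (F ∘ suc) r))
  where
  S : Series
  S s = sum (λ i → F (suc i) s)
  lin-+ : ∀ r → lin a (λ s → F zero s + S s) r ≡ lin a (F zero) r + lin a S r
  lin-+ zero    = solve 4 (λ p q x y → p :* (x :+ y) :+ q :* con 0ℚ := p :* x :+ q :* con 0ℚ :+ (p :* y :+ q :* con 0ℚ)) refl
                    (proj₁ a) (proj₂ a) (F zero 0) (S 0)
  lin-+ (suc r) = solve 6 (λ p q x y z w → p :* (x :+ y) :+ q :* (z :+ w) := p :* x :+ q :* z :+ (p :* y :+ q :* w)) refl
                    (proj₁ a) (proj₂ a) (F zero (suc r)) (S (suc r)) (F zero r) (S r)

-- Euler's identity for a product of k factors p + q y: applying k - y d/dy to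
-- it replaces each factor in turn by its constant term.
rowProduct-euler : ∀ {n k} (rows : Vec (Row n) k) σ r →
  sum (λ i → proj₁ (lookup rows i (lookup σ i)) * rowProduct (rows [ i ]≔ one) σ r) ≡
  (fromℕ k + - fromℕ r) * rowProduct rows σ r
rowProduct-euler [] [] zero    = refl
rowProduct-euler [] [] (suc r) = sym (ℚ.*-zeroʳ (0ℚ + - fromℕ (suc r)))
rowProduct-euler {k = suc k} (ρ ∷ rows) (j ∷ σ) r = begin
  p * lin (1ℚ , 0ℚ) f r + sum (λ i → P i * lin a (F i) r)
    ≡⟨ cong₂ _+_ (cong (p *_) (lin-1 f r)) (trans (sum-cong-≗ λ i → sym (lin-scale a (P i) (F i) r)) (sym (lin-sum a (λ i s → P i * F i s) r))) ⟩
  p * f r + lin a (λ s → sum (λ i → P i * F i s)) r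
    ≡⟨ cong (p * f r +_) (lin-cong a (rowProduct-euler rows σ) r) ⟩
  p * f r + lin a (λ s → (fromℕ k + - fromℕ s) * f s) r
    ≡⟨ final r ⟩
  (fromℕ (suc k) + - fromℕ r) * lin a f r ∎
  where
  a = ρ j
  p = proj₁ a
  q = proj₂ a
  f = rowProduct rows σ
  P : Fin k → ℚ
  P i = proj₁ (lookup rows i (lookup σ i))
  F : Fin k → Series
  F i = rowProduct (rows [ i ]≔ one) σ
  constant-term : ∀ p q k z x → p * x + (p * ((k + z) * x) + q * 0ℚ) ≡ (1ℚ + k + z) * (p * x + q * 0ℚ)
  constant-term = solve 5 (λ p q k z x → p :* x :+ (p :* ((k :+ z) :* x) :+ q :* con 0ℚ) := (con 1ℚ :+ k :+ z) :* (p :* x :+ q :* con 0ℚ)) refl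
  higher-terms : ∀ p q k r x y → p * x + (p * ((k + - (1ℚ + r)) * x) + q * ((k + - r) * y)) ≡ (1ℚ + k + - (1ℚ + r)) * (p * x + q * y)
  higher-terms = solve 6 (λ p q k r x y → p :* x :+ (p :* ((k :+ :- (con 1ℚ :+ r)) :* x) :+ q :* ((k :+ :- r) :* y)) :=
                             (con 1ℚ :+ k :+ :- (con 1ℚ :+ r)) :* (p :* x :+ q :* y)) refl
  -- The shifted part already carries k - (r - 1) = (k + 1) - r, and the extra summand p f(r) raises
  -- k - r to the same factor.
  final : ∀ r → p * f r + lin a (λ s → (fromℕ k + - fromℕ s) * f s) r ≡ (fromℕ (suc k) + - fromℕ r) * lin a f r
  final zero = trans (constant-term p q (fromℕ k) (- fromℕ 0) (f 0)) (cong (λ z → (z + - fromℕ 0) * lin a f 0) (sym (fromℕ-suc k)))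
  final (suc r) = begin
    p * f (suc r) + (p * ((fromℕ k + - fromℕ (suc r)) * f (suc r)) + q * ((fromℕ k + - fromℕ r) * f r))
      ≡⟨ cong (λ z → p * f (suc r) + (p * ((fromℕ k + - z) * f (suc r)) + q * ((fromℕ k + - fromℕ r) * f r))) (fromℕ-suc r) ⟩
    p * f (suc r) + (p * ((fromℕ k + - (1ℚ + fromℕ r)) * f (suc r)) + q * ((fromℕ k + - fromℕ r) * f r))
      ≡⟨ higher-terms p q (fromℕ k) (fromℕ r) (f (suc r)) (f r) ⟩
    (1ℚ + fromℕ k + - (1ℚ + fromℕ r)) * lin a f (suc r)
      ≡⟨ cong₂ (λ y z → (y + - z) * lin a f (suc r)) (sym (fromℕ-suc k)) (sym (fromℕ-suc r)) ⟩
    (fromℕ (suc k) + - fromℕ (suc r)) * lin a f (suc r) ∎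

-- Newton's recursion

δ : ∀ {n} → Fin n → Fin n → ℚ
δ i j = [ does (i Fin.≟ j) ]ᴮ

δ-sym : ∀ {n} (i j : Fin n) → δ i j ≡ δ j i
δ-sym i j with i Fin.≟ j
... | yes refl = sym ([]ᴮ-≡1 _ (⇒T-does (i Fin.≟ i) refl))
... | no i≢j   = sym ([]ᴮ-≡0 _ (i≢j ∘ sym ∘ T-does⇒ (j Fin.≟ i)))

-- The matrix I - y A, whose determinant is the reversed characteristic
-- polynomial of A.
module ReversedCharacteristic {n} (A : Fin n → Fin n → ℚ) where

  rowOf : Fin n → Row n
  rowOf i j = δ i j , - A i j

  rows : Vec (Row n) n
  rows = tabulate rowOf

  c : Series
  c = determinant rows

  -- (I - y A) adj(I - y A) = det(I - y A) I: replacing row i by row j gives a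
  -- repeated row unless i = j.
  cofactor-recursion : ∀ i j r →
    cofactor rows i j r ≡ δ i j * c r + sum (λ l → A j l * shift (cofactor rows i l) r)
  cofactor-recursion i j r = begin
    C j r                                                       ≡⟨ solve 2 (λ x y → x := x :+ :- y :+ y) refl (C j r) S ⟩
    C j r + - S + S                                             ≡⟨ cong (_+ S) (sym expanded) ⟩
    determinant (rows [ i ]≔ rowOf j) r + S                      ≡⟨ cong (_+ S) (same-or-repeated (i Fin.≟ j)) ⟩
    δ i j * c r + S                                             ∎
    where
    C : Fin n → Series
    C = cofactor rows i
    S = sum (λ l → A j l * shift (C l) r)
    expanded : determinant (rows [ i ]≔ rowOf j) r ≡ C j r + - S
    expanded = begin
      determinant (rows [ i ]≔ rowOf j) r
        ≡⟨ determinant-expand rows i (rowOf j) r ⟩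
      sum (λ l → δ j l * C l r + (- A j l) * shift (C l) r)
        ≡⟨ ∑-distrib-+ (λ l → δ j l * C l r) (λ l → (- A j l) * shift (C l) r) ⟩
      sum (λ l → δ j l * C l r) + sum (λ l → (- A j l) * shift (C l) r)
        ≡⟨ cong₂ _+_ (∑-delta j (λ l → C l r))
             (trans (sum-cong-≗ λ l → sym (ℚ.neg-distribˡ-* (A j l) (shift (C l) r))) (∑-neg (λ l → A j l * shift (C l) r))) ⟩
      C j r + - S ∎
    same-or-repeated : (i≟j : Dec (i ≡ j)) → determinant (rows [ i ]≔ rowOf j) r ≡ [ does i≟j ]ᴮ * c r
    same-or-repeated (yes refl) = trans
      (cong (λ v → determinant v r) (trans (cong (rows [ i ]≔_) (sym (Vec.lookup∘tabulate rowOf i))) (Vec.[]≔-lookup rows i)))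
      (sym (ℚ.*-identityˡ (c r)))
    same-or-repeated (no i≢j) = trans (repeated rows i j (rowOf j) i≢j (Vec.lookup∘tabulate rowOf j)) (sym (ℚ.*-zeroˡ (c r)))
      where
      repeated : ∀ {k} (v : Vec (Row n) k) i j ρ → i ≢ j → lookup v j ≡ ρ → determinant (v [ i ]≔ ρ) r ≡ 0ℚ
      repeated {suc k} v i j ρ i≢j e = alternating-repeat (λ w → determinant w r) (determinant-alternating r) (v [ i ]≔ ρ) i j i≢j
        (trans (Vec.lookup∘updateAt i v) (trans (sym e) (sym (Vec.lookup∘updateAt′ j i (i≢j ∘ sym) v))))

  -- The constant terms of I - y A form the identity matrix, so the delta in the cofactor of (i, i)
  -- is the constant term of the entry that σ selects in row i. Euler's identity then applies to
  -- each σ.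
  cofactor-trace : ∀ r → sum (λ i → cofactor rows i i r) ≡ (fromℕ n + - fromℕ r) * c r
  cofactor-trace r = begin
    sum (λ i → ∑ᵛ n (λ σ → ε σ * (δ (lookup σ i) i * rest i σ)))
      ≡⟨ ∑ᵛ-∑ n (λ i σ → ε σ * (δ (lookup σ i) i * rest i σ)) ⟩
    ∑ᵛ n (λ σ → sum (λ i → ε σ * (δ (lookup σ i) i * rest i σ)))
      ≡⟨ ∑ᵛ-cong n (λ σ → trans (sym (*-distribˡ-sum (ε σ) (λ i → δ (lookup σ i) i * rest i σ)))
           (cong (ε σ *_) (trans (sum-cong-≗ λ i → cong (_* rest i σ)
             (trans (δ-sym (lookup σ i) i) (sym (cong (λ ρ → proj₁ (ρ (lookup σ i))) (Vec.lookup∘tabulate rowOf i)))))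
             (rowProduct-euler rows σ r)))) ⟩
    ∑ᵛ n (λ σ → ε σ * ((fromℕ n + - fromℕ r) * rowProduct rows σ r))
      ≡⟨ ∑ᵛ-cong n (λ σ → solve 3 (λ e x y → e :* (x :* y) := x :* (e :* y)) refl (ε σ) (fromℕ n + - fromℕ r) (rowProduct rows σ r)) ⟩
    ∑ᵛ n (λ σ → (fromℕ n + - fromℕ r) * (ε σ * rowProduct rows σ r))
      ≡⟨ ∑ᵛ-* n (fromℕ n + - fromℕ r) (λ σ → ε σ * rowProduct rows σ r) ⟩
    (fromℕ n + - fromℕ r) * c r ∎
    where
    rest : Fin n → Vec (Fin n) n → ℚ
    rest i σ = rowProduct (rows [ i ]≔ one) σ r

  -- `walk i j u` follows u from j back to i, so that `power s` is A^s.
  walk : ∀ {s} → Fin n → Fin n → Vec (Fin n) s → ℚ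
  walk i j []      = δ i j
  walk i j (l ∷ u) = A l j * walk i l u

  power : ℕ → Fin n → Fin n → ℚ
  power s i j = ∑ᵛ s (walk i j)

  trace : ℕ → ℚ
  trace s = sum (λ i → power s i i)

  -- tr (A^s adj(I - y A))
  powerTrace : ℕ → Series
  powerTrace s r = sum (λ i → sum (λ j → power s i j * cofactor rows i j r))

  -- `cofactor-recursion` multiplied by A^s: its delta picks out a diagonal entry of A^s, and the
  -- factor A of its other term joins the power.
  power-cofactor : ∀ s i r →
    sum (λ j → power s i j * cofactor rows i j r) ≡
    power s i i * c r + sum (λ l → power (suc s) i l * shift (cofactor rows i l) r)
  power-cofactor s i r = begin
    sum (λ j → W j * C j r)
      ≡⟨ sum-cong-≗ (λ j → trans (cong (W j *_) (cofactor-recursion i j r))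
           (solve 4 (λ w d c s → w :* (d :* c :+ s) := d :* (w :* c) :+ w :* s) refl (W j) (δ i j) (c r) (S j))) ⟩
    sum (λ j → δ i j * (W j * c r) + W j * S j)
      ≡⟨ ∑-distrib-+ (λ j → δ i j * (W j * c r)) (λ j → W j * S j) ⟩
    sum (λ j → δ i j * (W j * c r)) + sum (λ j → W j * S j)
      ≡⟨ cong₂ _+_ (∑-delta i (λ j → W j * c r)) moved ⟩
    W i * c r + sum (λ l → power (suc s) i l * shift (C l) r) ∎
    where
    W = power s i
    C : Fin n → Series
    C = cofactor rows i
    S : Fin n → ℚ
    S j = sum (λ l → A j l * shift (C l) r)
    moved : sum (λ j → W j * S j) ≡ sum (λ l → power (suc s) i l * shift (C l) r)
    moved = begin
      sum (λ j → W j * S j)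
        ≡⟨ sum-cong-≗ (λ j → *-distribˡ-sum (W j) (λ l → A j l * shift (C l) r)) ⟩
      sum (λ j → sum (λ l → W j * (A j l * shift (C l) r)))
        ≡⟨ ∑-comm (λ j l → W j * (A j l * shift (C l) r)) ⟩
      sum (λ l → sum (λ j → W j * (A j l * shift (C l) r)))
        ≡⟨ sum-cong-≗ (λ l → trans
             (sum-cong-≗ λ j → solve 3 (λ w a x → w :* (a :* x) := a :* w :* x) refl (W j) (A j l) (shift (C l) r))
             (sym (*-distribʳ-sum (shift (C l) r) (λ j → A j l * W j)))) ⟩
      sum (λ l → sum (λ j → A j l * W j) * shift (C l) r)
        ≡⟨ sum-cong-≗ (λ l → cong (_* shift (C l) r) (sum-cong-≗ λ j → sym (∑ᵛ-* s (A j l) (walk i j)))) ⟩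
      sum (λ l → power (suc s) i l * shift (C l) r) ∎

  powerTrace-split : ∀ s r →
    powerTrace s r ≡ trace s * c r + sum (λ i → sum (λ l → power (suc s) i l * shift (cofactor rows i l) r))
  powerTrace-split s r = begin
    sum (λ i → sum (λ j → power s i j * cofactor rows i j r))  ≡⟨ sum-cong-≗ (λ i → power-cofactor s i r) ⟩
    sum (λ i → power s i i * c r + next i)                     ≡⟨ ∑-distrib-+ (λ i → power s i i * c r) next ⟩
    sum (λ i → power s i i * c r) + sum next                   ≡⟨ cong (_+ sum next) (sym (*-distribʳ-sum (c r) (λ i → power s i i))) ⟩
    trace s * c r + sum next                                   ∎
    where
    next : Fin n → ℚ
    next i = sum (λ l → power (suc s) i l * shift (cofactor rows i l) r)

  powerTrace-zero : ∀ s → powerTrace s 0 ≡ trace s * c 0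
  powerTrace-zero s = trans (powerTrace-split s 0) (trans
    (cong (trace s * c 0 +_) (trans (sum-cong-≗ λ i → trans (sum-cong-≗ λ l → ℚ.*-zeroʳ (power (suc s) i l)) (∑-zero n)) (∑-zero n)))
    (ℚ.+-identityʳ (trace s * c 0)))

  powerTrace-suc : ∀ s r → powerTrace s (suc r) ≡ trace s * c (suc r) + powerTrace (suc s) r
  powerTrace-suc s r = powerTrace-split s (suc r)

  -- The trace of the adjugate is computed twice, by `cofactor-trace` and by `powerTrace-suc` at s =
  -- 0; the multiples of n cancel. Unrolled by `powerTrace-suc`, the right-hand side is minus the
  -- sum of tr(A^t) c(r + 1 - t) over 1 ≤ t ≤ r + 1.
  newton : ∀ r → fromℕ (suc r) * c (suc r) ≡ - powerTrace 1 r
  newton r = begin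
    k * x                                         ≡⟨ solve 3 (λ n k x → k :* x := n :* x :+ :- ((n :+ :- k) :* x)) refl (fromℕ n) k x ⟩
    fromℕ n * x + - ((fromℕ n + - k) * x)          ≡⟨ cong (λ y → fromℕ n * x + - y) (begin
      (fromℕ n + - k) * x                           ≡⟨ cofactor-trace (suc r) ⟨
      sum (λ i → cofactor rows i i (suc r))         ≡⟨ sum-cong-≗ (λ i → ∑-delta i (λ j → cofactor rows i j (suc r))) ⟨
      powerTrace 0 (suc r)                          ≡⟨ powerTrace-suc 0 r ⟩
      trace 0 * x + powerTrace 1 r                  ≡⟨ cong (λ t → t * x + powerTrace 1 r) trace-zero ⟩
      fromℕ n * x + powerTrace 1 r                  ∎) ⟩
    fromℕ n * x + - (fromℕ n * x + powerTrace 1 r) ≡⟨ solve 2 (λ y z → y :+ :- (y :+ z) := :- z) refl (fromℕ n * x) (powerTrace 1 r) ⟩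
    - powerTrace 1 r                              ∎
    where
    k = fromℕ (suc r)
    x = c (suc r)
    trace-zero : trace 0 ≡ fromℕ n
    trace-zero = trans (sum-cong-≗ {n} λ i → []ᴮ-≡1 _ (⇒T-does (i Fin.≟ i) refl)) (∑-one n)

ε-increasing : ∀ {n k} (h : Fin k → Fin n) → (∀ {i j} → i Fin.< j → h i Fin.< h j) → ε (tabulate h) ≡ 1ℚ
ε-increasing {k = zero}  h inc = refl
ε-increasing {k = suc k} h inc =
  cong₂ _*_ (signs≡1 (h ∘ suc) (λ i → inc ℕ.z<s)) (ε-increasing (h ∘ suc) (λ i<j → inc (ℕ.s<s i<j)))
  where
  signs≡1 : ∀ {l n} {a : Fin n} (g : Fin l → Fin n) → (∀ i → a Fin.< g i) → signs a (tabulate g) ≡ 1ℚ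
  signs≡1 {zero}          g a<g = refl
  signs≡1 {suc l} {a = a} g a<g
    rewrite dec-false (a Fin.≟ g zero) (Fin.<⇒≢ (a<g zero)) | dec-false (g zero Fin.<? a) (Fin.<-asym (a<g zero))
          | signs≡1 (g ∘ suc) (a<g ∘ suc) = refl

-- At y = 0 row i is the unit vector at `h i`, so a single tuple survives. A general `h` lets the
-- induction drop rows; the application is `h = id`.
∑ᵛ-delta : ∀ {n k} (h : Fin k → Fin n) (ρ : Fin k → Row n) → (∀ i j → proj₁ (ρ i j) ≡ δ (h i) j) →
           (w : Vec (Fin n) k → ℚ) → ∑ᵛ k (λ σ → w σ * rowProduct (tabulate ρ) σ 0) ≡ w (tabulate h)
∑ᵛ-delta {k = zero}  h ρ eq w = ℚ.*-identityʳ (w [])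
∑ᵛ-delta {k = suc k} h ρ eq w = begin
  sum (λ j → ∑ᵛ k (λ σ → w (j ∷ σ) * lin (ρ zero j) (rowProduct (tabulate (ρ ∘ suc)) σ) 0))
    ≡⟨ sum-cong-≗ (λ j → trans (∑ᵛ-cong k λ σ → trans
         (cong (λ p → w (j ∷ σ) * (p * F σ + proj₂ (ρ zero j) * 0ℚ)) (eq zero j))
         (solve 4 (λ w d f q → w :* (d :* f :+ q :* con 0ℚ) := d :* (w :* f)) refl (w (j ∷ σ)) (δ (h zero) j) (F σ) (proj₂ (ρ zero j))))
         (∑ᵛ-* k (δ (h zero) j) (λ σ → w (j ∷ σ) * F σ))) ⟩
  sum (λ j → δ (h zero) j * ∑ᵛ k (λ σ → w (j ∷ σ) * F σ))
    ≡⟨ ∑-delta (h zero) (λ j → ∑ᵛ k (λ σ → w (j ∷ σ) * F σ)) ⟩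
  ∑ᵛ k (λ σ → w (h zero ∷ σ) * F σ)
    ≡⟨ ∑ᵛ-delta (h ∘ suc) (ρ ∘ suc) (λ i → eq (suc i)) (w ∘ (h zero ∷_)) ⟩
  w (tabulate h) ∎
  where
  F : Vec (Fin _) k → ℚ
  F σ = rowProduct (tabulate (ρ ∘ suc)) σ 0

c₀≡1 : ∀ {n} (A : Fin n → Fin n → ℚ) → ReversedCharacteristic.c A 0 ≡ 1ℚ
c₀≡1 {n} A = trans (∑ᵛ-delta id rowOf (λ i j → refl) ε) (ε-increasing {n} id id)
  where open ReversedCharacteristic A

-- The Leibniz formula in terms of the Levi-Civita symbol

signPower : ℕ → ℚ
signPower zero    = 1ℚ
signPower (suc k) = - signPower k

module _ {A : Set} where

  ∏ˡ : (A → ℚ) → List A → ℚ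
  ∏ˡ f = foldr (λ a s → f a * s) 1ℚ

  ∏ˡ-++ : ∀ f xs ys → ∏ˡ f (xs ++ ys) ≡ ∏ˡ f xs * ∏ˡ f ys
  ∏ˡ-++ f []       ys = sym (ℚ.*-identityˡ (∏ˡ f ys))
  ∏ˡ-++ f (x ∷ xs) ys = trans (cong (f x *_) (∏ˡ-++ f xs ys)) (sym (ℚ.*-assoc (f x) (∏ˡ f xs) (∏ˡ f ys)))

  ∏ˡ-tabulate : ∀ f {k} (h : Fin k → A) → ∏ˡ f (List.tabulate h) ≡ ∏ (f ∘ h)
  ∏ˡ-tabulate f {zero}  h = refl
  ∏ˡ-tabulate f {suc k} h = cong (f (h zero) *_) (∏ˡ-tabulate f (h ∘ suc))

  signPower-filter : ∀ {P : A → Set} (P? : Decidable P) xs →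
                     signPower (length (filter P? xs)) ≡ ∏ˡ (λ x → flip (does (P? x))) xs
  signPower-filter P? []       = refl
  signPower-filter P? (x ∷ xs) with does (P? x)
  ... | true  = trans (cong -_ (signPower-filter P? xs))
                  (solve 1 (λ y → :- y := con (- 1ℚ) :* y) refl (∏ˡ (λ x → flip (does (P? x))) xs))
  ... | false = trans (signPower-filter P? xs) (sym (ℚ.*-identityˡ (∏ˡ (λ x → flip (does (P? x))) xs)))

∏ˡ-map : ∀ {A B : Set} (f : B → ℚ) (h : A → B) xs → ∏ˡ f (List.map h xs) ≡ ∏ˡ (f ∘ h) xs
∏ˡ-map f h []       = refl
∏ˡ-map f h (x ∷ xs) = cong (f (h x) *_) (∏ˡ-map f h xs)

∏ˡ-cartesianProduct : ∀ {A B : Set} (f : A × B → ℚ) {k l} (g : Fin k → A) (h : Fin l → B) →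
  ∏ˡ f (cartesianProduct (List.tabulate g) (List.tabulate h)) ≡ ∏ (λ i → ∏ (λ j → f (g i , h j)))
∏ˡ-cartesianProduct f {zero}  g h = refl
∏ˡ-cartesianProduct f {suc k} g h = trans
  (∏ˡ-++ f (List.map (g zero ,_) (List.tabulate h)) (cartesianProduct (List.tabulate (g ∘ suc)) (List.tabulate h)))
  (cong₂ _*_ (trans (∏ˡ-map f (g zero ,_) (List.tabulate h)) (∏ˡ-tabulate (f ∘ (g zero ,_)) h)) (∏ˡ-cartesianProduct f (g ∘ suc) h))

∏-one : ∀ k → ∏ {k} (λ _ → 1ℚ) ≡ 1ℚ
∏-one zero    = refl
∏-one (suc k) = trans (ℚ.*-identityˡ (∏ {k} (λ _ → 1ℚ))) (∏-one k)

-- Injectivity excludes the sign 0. The product is spread over all pairs (i, j), those with i ≥ j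
-- contributing 1, to match `inversions`, which filters the full square of index pairs.
ε-inversions : ∀ {n k} (v : Vec (Fin n) k) → (∀ i j → lookup v i ≡ lookup v j → i ≡ j) →
  ε v ≡ ∏ (λ i → ∏ (λ j → flip (does (i Fin.<? j) ∧ does (lookup v j Fin.<? lookup v i))))
ε-inversions []      inj = refl
ε-inversions {k = suc k} (a ∷ v) inj = cong₂ _*_
  (trans (signs-flip v λ i e → contradiction (inj zero (suc i) e) λ ())
    (sym (ℚ.*-identityˡ (∏ (λ j → flip (does (lookup v j Fin.<? a)))))))
  (trans (ε-inversions v (λ i j e → Fin.suc-injective (inj (suc i) (suc j) e)))
    (∏-cong {k} λ i → sym (ℚ.*-identityˡ (∏ (λ j → flip (does (i Fin.<? j) ∧ does (lookup v j Fin.<? lookup v i)))))))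
  where
  signs-flip : ∀ {l} (w : Vec (Fin _) l) → (∀ i → a ≢ lookup w i) → signs a w ≡ ∏ (λ j → flip (does (lookup w j Fin.<? a)))
  signs-flip []      a∉w = refl
  signs-flip (b ∷ w) a∉w = cong₂ _*_
    (cong (λ t → if t then 0ℚ else flip (does (b Fin.<? a))) (dec-false (a Fin.≟ b) (a∉w zero)))
    (signs-flip w (a∉w ∘ suc))

ε-permutation : ∀ {n} (σ : Vec (Fin n) n) (f : ℚ) →
  (if does (isInjective? σ) then signPower (inversions σ) * f else 0ℚ) ≡ ε σ * f
ε-permutation {n} σ f = go (isInjective? σ)
  where
  repeated : ∀ {k} (v : Vec (Fin n) k) → ¬ (∀ i j → lookup v i ≡ lookup v j → i ≡ j) → ε v ≡ 0ℚ
  repeated {zero}  v ¬inj = contradiction (λ ()) ¬inj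
  repeated {suc k} v ¬inj with any? (λ i → any? λ j → (lookup v i Fin.≟ lookup v j) ×-dec ¬? (i Fin.≟ j))
  ... | yes (i , j , e , i≢j) = alternating-repeat ε ε-alternating v i j i≢j e
  ... | no none = contradiction (λ i j e → decidable-stable (i Fin.≟ j) λ i≢j → none (i , j , e , i≢j)) ¬inj
  go : (inj? : Dec (IsInjective σ)) → (if does inj? then signPower (inversions σ) * f else 0ℚ) ≡ ε σ * f
  go (yes inj) = cong (_* f) (trans (signPower-filter _ (cartesianProduct (allFin n) (allFin n)))
                  (trans (∏ˡ-cartesianProduct (λ (i , j) → flip (does (i Fin.<? j) ∧ does (lookup σ j Fin.<? lookup σ i))) {n} {n} id id) (sym (ε-inversions σ inj))))
  go (no ¬inj) = sym (trans (cong (_* f) (repeated σ ¬inj)) (ℚ.*-zeroˡ f))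

reversal-signed : ∀ k {d p f} → Reversal d p f → Reversal d (signed k p) (λ r → signPower k * f r)
reversal-signed zero    {f = f} R = reversal-cong (λ r → sym (ℚ.*-identityˡ (f r))) R
reversal-signed (suc k) {f = f} R = reversal-cong (λ r → ℚ.neg-distribˡ-* (signPower k) (f r)) (reversal-neg (reversal-signed k R))

reversal-∑ˡ : ∀ {A : Set} {t : A → Polynomial} {f : A → Series} {d} → (∀ a → Reversal d (t a) (f a)) → ∀ xs →
              Reversal d (foldr _⊕_ [] (List.map t xs)) (λ r → ∑ˡ (λ a → f a r) xs)
reversal-∑ˡ R []       = reversal-zero λ _ → refl
reversal-∑ˡ R (x ∷ xs) = reversal-⊕ (R x) (reversal-∑ˡ R xs)

∑ˡ-filter : ∀ {A : Set} {P : A → Set} (P? : Decidable P) (f : A → ℚ) xs →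
            ∑ˡ f (filter P? xs) ≡ ∑ˡ (λ a → if does (P? a) then f a else 0ℚ) xs
∑ˡ-filter P? f []       = refl
∑ˡ-filter P? f (x ∷ xs) with does (P? x)
... | true  = cong (f x +_) (∑ˡ-filter P? f xs)
... | false = trans (∑ˡ-filter P? f xs) (sym (ℚ.+-identityˡ (∑ˡ (λ a → if does (P? a) then f a else 0ℚ) xs)))

-- The two list shapes occurring in xI - A: two coefficients on the diagonal, one off it.
IsLinear : Polynomial → ℚ × ℚ → Set
IsLinear P (p , q) = (P ≡ q ∷ p ∷ []) ⊎ (P ≡ q ∷ [] × p ≡ 0ℚ)

reversal-linearFactor : ∀ {P a d Q f} → IsLinear P a → Reversal d Q f → Reversal (suc d) (P ⊗ Q) (lin a f)
reversal-linearFactor {a = p , q} (inj₁ refl)          R = reversal-linear p q R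
reversal-linearFactor {a = _ , q} (inj₂ (refl , refl)) R = reversal-constant q R

reversal-rowProduct : ∀ {n k} (M : Fin k → Fin n → Polynomial) (ρ : Fin k → Row n) → (∀ i j → IsLinear (M i j) (ρ i j)) →
  ∀ σ → Reversal k (foldr _⊗_ (const 1ℚ) (List.tabulate λ i → M i (lookup σ i))) (rowProduct (tabulate ρ) σ)
reversal-rowProduct M ρ lin []      = reversal-1
reversal-rowProduct M ρ lin (j ∷ σ) = reversal-linearFactor (lin zero j) (reversal-rowProduct (M ∘ suc) (ρ ∘ suc) (lin ∘ suc) σ)

reversal-det : ∀ {n} (M : Fin n → Fin n → Polynomial) (ρ : Fin n → Row n) → (∀ i j → IsLinear (M i j) (ρ i j)) →
  Reversal n (det n M) (determinant (tabulate ρ))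
reversal-det {n} M ρ linear = reversal-cong
  (λ r → trans (∑ˡ-filter isInjective? (λ σ → signPower (inversions σ) * rowProduct (tabulate ρ) σ r) (maps n n))
         (trans (∑ˡ-maps n n (λ σ → if does (isInjective? σ) then signPower (inversions σ) * rowProduct (tabulate ρ) σ r else 0ℚ))
           (∑ᵛ-cong n λ σ → ε-permutation σ (rowProduct (tabulate ρ) σ r))))
  (reversal-∑ˡ (λ σ → reversal-signed (inversions σ) (reversal-rowProduct M ρ linear σ)) (permutations n))

reversal-characteristicPolynomial : ∀ G →
  Reversal (order G) (characteristicPolynomial G) (ReversedCharacteristic.c (adjacencyMatrix G))
reversal-characteristicPolynomial G = reversal-det _ (ReversedCharacteristic.rowOf (adjacencyMatrix G)) linear
  where
  linear : ∀ i j → IsLinear ((if does (i Fin.≟ j) then X else []) ⊕ neg (const (adjacencyMatrix G i j))) (δ i j , - adjacencyMatrix G i j)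
  linear i j with does (i Fin.≟ j)
  ... | true  = inj₁ (cong (_∷ 1ℚ ∷ []) (ℚ.+-identityˡ (- adjacencyMatrix G i j)))
  ... | false = inj₂ (refl , refl)

-- Coefficients of the characteristic polynomial

module CharacteristicCoefficients (G : ℕ → Graph) (G-poly : StronglyPolynomial G) where

  open Counting G G-poly
  module R n = ReversedCharacteristic (adjacencyMatrix (G n))

  definable-walk : ∀ {k s} (i j : Fin k) (ls : Vec (Fin k) s) →
    Definable (λ n u → R.walk n (lookup u i) (lookup u j) (Vec.map (lookup u) ls))
  definable-walk i j []       = definable-equality i j .DefinableBool.indicator
  definable-walk i j (l ∷ ls) = definable-* (definable-edge l j) (definable-walk i l ls)

  trace-isPolynomial : ∀ s → IsPolynomial (λ n → R.trace n s)
  trace-isPolynomial s = isPolynomial-cong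
    (λ n → sum-cong-≗ λ i → ∑ᵛ-cong s λ u → cong (R.walk n i i)
      (trans (sym (Vec.tabulate-∘ (lookup (i ∷ u)) suc)) (Vec.tabulate∘lookup u)))
    -- Entry `zero` is the base vertex; the other s entries are the later vertices of the walk,
    -- whose end is tied to the base by the delta in `walk`.
    (definable⇒isPolynomial (definable-walk zero zero (tabulate {n = s} suc)))

  powerTrace-isPolynomial : ∀ r s → (∀ t → t ℕ.≤ r → IsPolynomial (λ n → R.c n t)) → IsPolynomial (λ n → R.powerTrace n s r)
  powerTrace-isPolynomial zero    s c-poly = isPolynomial-cong (λ n → sym (R.powerTrace-zero n s))
    (isPolynomial-* (trace-isPolynomial s) (c-poly 0 ℕ.z≤n))
  powerTrace-isPolynomial (suc r) s c-poly = isPolynomial-cong (λ n → sym (R.powerTrace-suc n s r))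
    (isPolynomial-+ (isPolynomial-* (trace-isPolynomial s) (c-poly (suc r) ℕ.≤-refl))
      (powerTrace-isPolynomial r (suc s) λ t t≤r → c-poly t (ℕ.m≤n⇒m≤1+n t≤r)))

  -- The bound r carries a strong induction, because Newton's recursion for c(t + 1) uses all of
  -- c(0), ..., c(t).
  coefficients-isPolynomial : ∀ r t → t ℕ.≤ r → IsPolynomial (λ n → R.c n t)
  coefficients-isPolynomial r       zero    _           = isPolynomial-cong (λ n → sym (c₀≡1 (adjacencyMatrix (G n)))) (isPolynomial-const 1ℚ)
  coefficients-isPolynomial (suc r) (suc t) (ℕ.s≤s t≤r) = isPolynomial-divide t {g = λ n → - 1ℚ * R.powerTrace n 1 t}
    (λ n → trans (R.newton n t) (solve 1 (λ x → :- x := con (- 1ℚ) :* x) refl (R.powerTrace n 1 t)))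
    (isPolynomial-* (isPolynomial-const (- 1ℚ))
      (powerTrace-isPolynomial t 1 λ t′ t′≤t → coefficients-isPolynomial r t′ (ℕ.≤-trans t′≤t t≤r)))

  characteristic-isTwoLevel : IsTwoLevelPolynomialOfInfiniteDepth (λ n → characteristicPolynomial (G n))
  characteristic-isTwoLevel = isTwoLevelOfInfiniteDepth _ R.c (λ n → order (G n))
    (λ n → reversal-characteristicPolynomial (G n)) (λ n → c₀≡1 (adjacencyMatrix (G n)))
    order-isPolynomial (λ r → coefficients-isPolynomial r r ℕ.≤-refl)

-- The graphic matroid

T-ext : ∀ {a b} → (T a → T b) → (T b → T a) → a ≡ b
T-ext {true}  {true}  _ _ = refl
T-ext {true}  {false} f _ = contradiction _ f
T-ext {false} {true}  _ g = contradiction _ g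
T-ext {false} {false} _ _ = refl

T⇒≡true : ∀ {b} → T b → b ≡ true
T⇒≡true {true} _ = refl

¬T⇒≡false : ∀ {b} → ¬ T b → b ≡ false
¬T⇒≡false {true}  ¬b = contradiction _ ¬b
¬T⇒≡false {false} ¬b = refl

≡true⇒T : ∀ {b} → b ≡ true → T b
≡true⇒T refl = _

-- An element already in the span leaves the rank unchanged; any other raises it by one, which is a
-- factor y.
step : Bool → Series → Series
step b f = if b then f else shift f

step-cong : ∀ b {f g} → f ≗ g → step b f ≗ step b g
step-cong true  eq = eq
step-cong false eq = shift-cong eq

step-neg : ∀ b f r → step b (λ s → - f s) r ≡ - step b f r
step-neg true  f r = refl
step-neg false f r = shift-neg f r

step-comm : ∀ p q p′ q′ f → (T p → q ≡ p′ × q′ ≡ true) → (T p′ → q′ ≡ p × q ≡ true) →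
            (¬ T p → ¬ T p′ → q ≡ q′) → step p (step q f) ≗ step p′ (step q′ f)
step-comm true  q true  q′ f h _  _ r with refl , refl ← h _ = refl
step-comm true  q false q′ f h _  _ r with refl , refl ← h _ = refl
step-comm false q true  q′ f _ h  _ r with refl , refl ← h _ = refl
step-comm false q false q′ f _ _  h r = cong (λ t → shift (step t f) r) (h id id)

-- Boolean-valued, so that joins of relations remain Boolean formulas in equalities of tuple entries
-- and hence definable.
Relᴮ : Set → Set
Relᴮ V = V → V → Bool

record Equivᴮ {V : Set} (R : Relᴮ V) : Set where
  field
    reflexive  : ∀ x → T (R x x)
    symmetric  : ∀ {x y} → T (R x y) → T (R y x)
    transitive : ∀ {x y z} → T (R x y) → T (R y z) → T (R x z)

module _ {V : Set} where

  -- For an equivalence relation R: the join of R with a ~ b.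
  glue : Relᴮ V → V × V → Relᴮ V
  glue R (a , b) x y = R x y ∨ (R x a ∧ R b y ∨ R x b ∧ R a y)

  glue-view : ∀ R a b {x y} → T (glue R (a , b) x y) →
              T (R x y) ⊎ (T (R x a) × T (R b y)) ⊎ (T (R x b) × T (R a y))
  glue-view R a b {x} {y} t with Equivalence.to (T-∨ {R x y}) t
  ... | inj₁ p = inj₁ p
  ... | inj₂ q with Equivalence.to (T-∨ {R x a ∧ R b y}) q
  ...   | inj₁ p = inj₂ (inj₁ (Equivalence.to (T-∧ {R x a}) p))
  ...   | inj₂ p = inj₂ (inj₂ (Equivalence.to (T-∧ {R x b}) p))

  glue-⊇ : ∀ R e {x y} → T (R x y) → T (glue R e x y)
  glue-⊇ R (a , b) {x} {y} p = Equivalence.from (T-∨ {R x y}) (inj₁ p)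

  glue-via : ∀ R a b {x y} → T (R x a) → T (R b y) → T (glue R (a , b) x y)
  glue-via R a b {x} {y} p q = Equivalence.from (T-∨ {R x y})
    (inj₂ (Equivalence.from (T-∨ {R x a ∧ R b y}) (inj₁ (Equivalence.from (T-∧ {R x a}) (p , q)))))

  glue-via′ : ∀ R a b {x y} → T (R x b) → T (R a y) → T (glue R (a , b) x y)
  glue-via′ R a b {x} {y} p q = Equivalence.from (T-∨ {R x y})
    (inj₂ (Equivalence.from (T-∨ {R x a ∧ R b y}) (inj₂ (Equivalence.from (T-∧ {R x b}) (p , q)))))

  glue-equiv : ∀ {R} → Equivᴮ R → ∀ e → Equivᴮ (glue R e)
  glue-equiv {R} E (a , b) = record
    { reflexive  = λ x → glue-⊇ R (a , b) (reflexive x)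
    ; symmetric  = λ t → symm′ (glue-view R a b t)
    ; transitive = λ s t → trans′ (glue-view R a b s) (glue-view R a b t)
    }
    where
    open Equivᴮ E
    symm′ : ∀ {x y} → _ → T (glue R (a , b) y x)
    symm′ (inj₁ p)              = glue-⊇ R (a , b) (symmetric p)
    symm′ (inj₂ (inj₁ (p , q))) = glue-via′ R a b (symmetric q) (symmetric p)
    symm′ (inj₂ (inj₂ (p , q))) = glue-via R a b (symmetric q) (symmetric p)
    trans′ : ∀ {x y z} → T (R x y) ⊎ (T (R x a) × T (R b y)) ⊎ (T (R x b) × T (R a y)) →
             T (R y z) ⊎ (T (R y a) × T (R b z)) ⊎ (T (R y b) × T (R a z)) → T (glue R (a , b) x z)
    trans′ (inj₁ p)              (inj₁ q)              = glue-⊇ R (a , b) (transitive p q)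
    trans′ (inj₁ p)              (inj₂ (inj₁ (q , s))) = glue-via R a b (transitive p q) s
    trans′ (inj₁ p)              (inj₂ (inj₂ (q , s))) = glue-via′ R a b (transitive p q) s
    trans′ (inj₂ (inj₁ (p , q))) (inj₁ s)              = glue-via R a b p (transitive q s)
    trans′ (inj₂ (inj₂ (p , q))) (inj₁ s)              = glue-via′ R a b p (transitive q s)
    trans′ (inj₂ (inj₁ (p , q))) (inj₂ (inj₁ (s , t))) = glue-via R a b p t
    trans′ (inj₂ (inj₁ (p , q))) (inj₂ (inj₂ (s , t))) = glue-⊇ R (a , b) (transitive p t)
    trans′ (inj₂ (inj₂ (p , q))) (inj₂ (inj₁ (s , t))) = glue-⊇ R (a , b) (transitive p t)
    trans′ (inj₂ (inj₂ (p , q))) (inj₂ (inj₂ (s , t))) = glue-via′ R a b p t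

  glue-least : ∀ {R S a b} → Equivᴮ S → (∀ {x y} → T (R x y) → T (S x y)) → T (S a b) →
               ∀ {x y} → T (glue R (a , b) x y) → T (S x y)
  glue-least {R} {S} {a} {b} E R⊆S ab t with glue-view R a b t
  ... | inj₁ p              = R⊆S p
  ... | inj₂ (inj₁ (p , q)) = Equivᴮ.transitive E (R⊆S p) (Equivᴮ.transitive E ab (R⊆S q))
  ... | inj₂ (inj₂ (p , q)) = Equivᴮ.transitive E (R⊆S p) (Equivᴮ.transitive E (Equivᴮ.symmetric E ab) (R⊆S q))

  glue-joins : ∀ {R} → Equivᴮ R → ∀ a b → T (glue R (a , b) a b)
  glue-joins {R} E a b = glue-via R a b (Equivᴮ.reflexive E a) (Equivᴮ.reflexive E b)

  glue-redundant : ∀ {R a b} → Equivᴮ R → T (R a b) → ∀ x y → glue R (a , b) x y ≡ R x y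
  glue-redundant {R} E ab x y = T-ext (glue-least E id ab) (glue-⊇ R _)

  glue-comm : ∀ {R} → Equivᴮ R → ∀ e f x y → glue (glue R e) f x y ≡ glue (glue R f) e x y
  glue-comm {R} E e f x y = T-ext (one-way e f) (one-way f e)
    where
    one-way : ∀ e f → T (glue (glue R e) f x y) → T (glue (glue R f) e x y)
    one-way e@(a , b) f@(c , d) = glue-least E″
      (glue-least E″ (glue-⊇ (glue R f) e ∘ glue-⊇ R f) (glue-joins (glue-equiv E f) a b))
      (glue-⊇ (glue R f) e (glue-joins E c d))
      where E″ = glue-equiv (glue-equiv E f) e

  -- (-1)^|A| y^(rank A), where the rank is that of the graphic matroid
  -- after contraction of the classes of R.
  rankSeries : Relᴮ V → List (V × V) → Series
  rankSeries R []              = 1ˢ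
  rankSeries R (e@(a , b) ∷ A) = λ r → - step (R a b) (rankSeries (glue R e) A) r

  glue-cong : ∀ {R S : Relᴮ V} → (∀ x y → R x y ≡ S x y) → ∀ e x y → glue R e x y ≡ glue S e x y
  glue-cong R≗S (a , b) x y
    rewrite R≗S x y | R≗S x a | R≗S b y | R≗S x b | R≗S a y = refl

  rankSeries-cong : ∀ {R S : Relᴮ V} → (∀ x y → R x y ≡ S x y) → ∀ A → rankSeries R A ≗ rankSeries S A
  rankSeries-cong R≗S []            r = refl
  rankSeries-cong {R} {S} R≗S ((a , b) ∷ A) r = cong -_ (trans
    (cong (λ t → step t (rankSeries (glue R (a , b)) A) r) (R≗S a b))
    (step-cong (S a b) (rankSeries-cong (glue-cong R≗S (a , b)) A) r))

  -- The exchange property of the matroid: if neither pair is related by R, then joining a ~ b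
  -- relates c and d exactly when joining c ~ d relates a and b. If one pair is already related,
  -- gluing it changes nothing.
  step-exchange : ∀ {R} → Equivᴮ R → ∀ a b c d f →
    step (R a b) (step (glue R (a , b) c d) f) ≗ step (R c d) (step (glue R (c , d) a b) f)
  step-exchange {R} E a b c d f = step-comm (R a b) (glue R (a , b) c d) (R c d) (glue R (c , d) a b) f
    (λ ab → glue-redundant E ab c d , T⇒≡true (glue-⊇ R (c , d) ab))
    (λ cd → glue-redundant E cd a b , T⇒≡true (glue-⊇ R (a , b) cd))
    (λ ¬ab ¬cd → T-ext (one-way a b c d ¬cd) (one-way c d a b ¬ab))
    where
    open Equivᴮ E
    one-way : ∀ a b c d → ¬ T (R c d) → T (glue R (a , b) c d) → T (glue R (c , d) a b)
    one-way a b c d ¬cd t with glue-view R a b t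
    ... | inj₁ cd               = contradiction cd ¬cd
    ... | inj₂ (inj₁ (ca , bd)) = glue-via R c d (symmetric ca) (symmetric bd)
    ... | inj₂ (inj₂ (cb , ad)) = glue-via′ R c d ad cb

  rankSeries-swap : ∀ {R} → Equivᴮ R → ∀ xs e f A → rankSeries R (xs ++ e ∷ f ∷ A) ≗ rankSeries R (xs ++ f ∷ e ∷ A)
  rankSeries-swap {R} E (x ∷ xs) e f A r = cong -_ (step-cong (R _ _) (rankSeries-swap (glue-equiv E x) xs e f A) r)
  rankSeries-swap {R} E [] e@(a , b) f@(c , d) A r = cong -_ (begin
    step (R a b) (λ s → - step (glue R e c d) f₁₂ s) r ≡⟨ step-neg (R a b) (step (glue R e c d) f₁₂) r ⟩
    - step (R a b) (step (glue R e c d) f₁₂) r         ≡⟨ cong -_ (step-exchange E a b c d f₁₂ r) ⟩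
    - step (R c d) (step (glue R f a b) f₁₂) r         ≡⟨ cong -_ (step-cong (R c d) (step-cong (glue R f a b) (rankSeries-cong (glue-comm E e f) A)) r) ⟩
    - step (R c d) (step (glue R f a b) f₂₁) r         ≡⟨ step-neg (R c d) (step (glue R f a b) f₂₁) r ⟨
    step (R c d) (λ s → - step (glue R f a b) f₂₁ s) r ∎)
    where
    f₁₂ = rankSeries (glue (glue R e) f) A
    f₂₁ = rankSeries (glue (glue R f) e) A

  private
    left : ∀ {x y : V} {S} → x ≡ y ⊎ (x ∈ S × y ∈ S) → y ∈ S → x ∈ S
    left (inj₁ refl)      y∈S = y∈S
    left (inj₂ (x∈S , _)) _   = x∈S

    right : ∀ {x y : V} {S} → x ≡ y ⊎ (x ∈ S × y ∈ S) → x ∈ S → y ∈ S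
    right (inj₁ refl)      x∈S = x∈S
    right (inj₂ (_ , y∈S)) _   = y∈S

  Supported : Relᴮ V → List V → Set
  Supported R S = ∀ {x y} → T (R x y) → x ≡ y ⊎ (x ∈ S × y ∈ S)

  glue-supported : ∀ {R S a b} → Supported R S → a ∈ S → b ∈ S → Supported (glue R (a , b)) S
  glue-supported {R} {S} {a} {b} sup a∈S b∈S t with glue-view R a b t
  ... | inj₁ p              = sup p
  ... | inj₂ (inj₁ (p , q)) = inj₂ (left (sup p) a∈S , right (sup q) b∈S)
  ... | inj₂ (inj₂ (p , q)) = inj₂ (left (sup p) b∈S , right (sup q) a∈S)

  Loopless : List (V × V) → Set
  Loopless = All (uncurry _≢_)

  -- A loopless edge set of rank r has at most 2r non-isolated vertices.
  rank-support : ∀ A {R S} r → Supported R S → Loopless A → rankSeries R A r ≢ 0ℚ →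
    ∃[ S′ ] (∀ {x} → x ∈ S → x ∈ S′) × length S′ ℕ.≤ r ℕ.+ r ℕ.+ length S × All (λ (a , b) → a ∈ S′ × b ∈ S′) A
  rank-support [] {S = S} r sup _ ≢0 = S , id , ℕ.m≤n+m (length S) (r ℕ.+ r) , []
  rank-support ((a , b) ∷ A) {R} {S} r sup (a≢b ∷ loopless) ≢0 with R a b in ab
  -- An edge that does not raise the rank joins two related vertices; as they differ, both lie in
  -- `S` already.
  ... | true with sup (≡true⇒T ab)
  ...   | inj₁ a≡b = contradiction a≡b a≢b
  ...   | inj₂ (a∈S , b∈S) with rank-support A r (glue-supported sup a∈S b∈S) loopless (≢0 ∘ cong -_)
  ...     | S′ , S⊆S′ , len , all = S′ , S⊆S′ , len , (S⊆S′ a∈S , S⊆S′ b∈S) ∷ all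
  rank-support ((a , b) ∷ A) zero sup (a≢b ∷ loopless) ≢0 | false = contradiction refl ≢0
  -- One unit of rank pays for the two new vertices a and b.
  rank-support ((a , b) ∷ A) {R} {S} (suc r) sup (a≢b ∷ loopless) ≢0 | false
    with rank-support A {S = a ∷ b ∷ S} r (glue-supported (λ t → map₂ (Product.map (there ∘ there) (there ∘ there)) (sup t)) (here refl) (there (here refl)))
                      loopless (≢0 ∘ cong -_)
  ... | S′ , S⊆S′ , len , all = S′ , S⊆S′ ∘ there ∘ there , ℕ.≤-trans len (ℕ.≤-reflexive arith) ,
                                (S⊆S′ (here refl) , S⊆S′ (there (here refl))) ∷ all
    where
    arith : r ℕ.+ r ℕ.+ suc (suc (length S)) ≡ suc r ℕ.+ suc r ℕ.+ length S
    arith = trans (ℕ.+-suc (r ℕ.+ r) _) (cong suc (trans (ℕ.+-suc (r ℕ.+ r) _) (cong (ℕ._+ length S) (sym (ℕ.+-suc r r)))))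

unique-length : ∀ {A : Set} {xs ys : List A} → Unique xs → (∀ {x} → x ∈ xs → x ∈ ys) → length xs ℕ.≤ length ys
unique-length [] _ = ℕ.z≤n
unique-length {xs = x ∷ xs} (x∉xs ∷ unique) xs⊆ys with ∈-∃++ (xs⊆ys (here refl))
... | ys₁ , ys₂ , refl = ℕ.≤-trans (ℕ.s≤s (unique-length unique without-x))
        (ℕ.≤-reflexive (trans (cong suc (List.length-++ ys₁)) (trans (sym (ℕ.+-suc (length ys₁) (length ys₂))) (sym (List.length-++ ys₁)))))
  where
  without-x : ∀ {y} → y ∈ xs → y ∈ ys₁ ++ ys₂
  without-x y∈xs with ∈-++⁻ ys₁ (xs⊆ys (there y∈xs))
  ... | inj₁ y∈ys₁         = ∈-++⁺ˡ y∈ys₁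
  ... | inj₂ (here refl)   = contradiction refl (All.lookup x∉xs y∈xs)
  ... | inj₂ (there y∈ys₂) = ∈-++⁺ʳ ys₁ y∈ys₂

-- Whitney's expansion

kernel : ∀ {N n} → (Fin N → Fin n) → Relᴮ (Fin N)
kernel μ x y = does (μ x Fin.≟ μ y)

kernel⇒≡ : ∀ {N n} (μ : Fin N → Fin n) {x y} → T (kernel μ x y) → μ x ≡ μ y
kernel⇒≡ μ {x} {y} = T-does⇒ (μ x Fin.≟ μ y)

≡⇒kernel : ∀ {N n} (μ : Fin N → Fin n) {x y} → μ x ≡ μ y → T (kernel μ x y)
≡⇒kernel μ {x} {y} = ⇒T-does (μ x Fin.≟ μ y)

kernel-equiv : ∀ {N n} (μ : Fin N → Fin n) → Equivᴮ (kernel μ)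
kernel-equiv μ = record
  { reflexive  = λ x → ≡⇒kernel μ {x} refl
  ; symmetric  = λ t → ≡⇒kernel μ (sym (kernel⇒≡ μ t))
  ; transitive = λ s t → ≡⇒kernel μ (trans (kernel⇒≡ μ s) (kernel⇒≡ μ t))
  }

merge-cases : ∀ {n} {i j : Fin (suc n)} (j≢i : j ≢ i) u v → merge j≢i u ≡ merge j≢i v →
              u ≡ v ⊎ (u ≡ i × j ≡ v) ⊎ (u ≡ j × i ≡ v)
merge-cases {j = j} j≢i u v e with j Fin.≟ u | j Fin.≟ v
... | yes refl | yes refl = inj₁ refl
... | yes refl | no j≢v   = inj₂ (inj₂ (refl , Fin.punchOut-injective j≢i j≢v e))
... | no j≢u   | yes refl = inj₂ (inj₁ (Fin.punchOut-injective j≢u j≢i e , refl))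
... | no j≢u   | no j≢v   = inj₁ (Fin.punchOut-injective j≢u j≢v e)

merge-identifies : ∀ {n} {i j : Fin (suc n)} (j≢i : j ≢ i) → merge j≢i i ≡ merge j≢i j
merge-identifies {i = i} {j} j≢i with j Fin.≟ i | j Fin.≟ j
... | yes j≡i | _       = contradiction j≡i j≢i
... | no  _   | yes refl = Fin.punchOut-cong j refl
... | no  _   | no j≢j  = contradiction refl j≢j

kernel-merge : ∀ {N n} (μ : Fin N → Fin (suc n)) {a b} (μb≢μa : μ b ≢ μ a) x y →
               glue (kernel μ) (a , b) x y ≡ kernel (merge μb≢μa ∘ μ) x y
kernel-merge μ {a} {b} μb≢μa x y = T-ext
  (glue-least (kernel-equiv μ′) (λ {x} {y} → ≡⇒kernel μ′ {x} {y} ∘ cong (merge μb≢μa) ∘ kernel⇒≡ μ {x} {y}) (≡⇒kernel μ′ {a} {b} (merge-identifies μb≢μa)))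
  (λ t → glued (merge-cases μb≢μa (μ x) (μ y) (kernel⇒≡ μ′ {x} {y} t)))
  where
  μ′ = merge μb≢μa ∘ μ
  glued : _ → T (glue (kernel μ) (a , b) x y)
  glued (inj₁ p)              = glue-⊇ (kernel μ) (a , b) {x} {y} (≡⇒kernel μ p)
  glued (inj₂ (inj₁ (p , q))) = glue-via (kernel μ) a b {x} {y} (≡⇒kernel μ p) (≡⇒kernel μ q)
  glued (inj₂ (inj₂ (p , q))) = glue-via′ (kernel μ) a b {x} {y} (≡⇒kernel μ p) (≡⇒kernel μ q)

module _ {E : Set} where

  ∑⊆ : (List E → ℚ) → List E → ℚ
  ∑⊆ f []       = f []
  ∑⊆ f (e ∷ es) = ∑⊆ f es + ∑⊆ (f ∘ (e ∷_)) es

  ∑⊆-cong : ∀ {f g} es → (∀ {A} → A ⊆ es → f A ≡ g A) → ∑⊆ f es ≡ ∑⊆ g es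
  ∑⊆-cong []       eq = eq []
  ∑⊆-cong (e ∷ es) eq = cong₂ _+_ (∑⊆-cong es λ A⊆ → eq (e ∷ʳ A⊆)) (∑⊆-cong es λ A⊆ → eq (refl ∷ A⊆))

  ∑⊆-neg : ∀ f es → ∑⊆ (λ A → - f A) es ≡ - ∑⊆ f es
  ∑⊆-neg f []       = refl
  ∑⊆-neg f (e ∷ es) = trans (cong₂ _+_ (∑⊆-neg f es) (∑⊆-neg (f ∘ (e ∷_)) es))
    (sym (ℚ.neg-distrib-+ (∑⊆ f es) (∑⊆ (f ∘ (e ∷_)) es)))

  ∑⊆-zero : ∀ es → ∑⊆ (λ _ → 0ℚ) es ≡ 0ℚ
  ∑⊆-zero []       = refl
  ∑⊆-zero (e ∷ es) = cong₂ _+_ (∑⊆-zero es) (∑⊆-zero es)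

  ∑⊆-shift : ∀ (f : List E → Series) es r → ∑⊆ (λ A → shift (f A) r) es ≡ shift (λ s → ∑⊆ (λ A → f A s) es) r
  ∑⊆-shift f es zero    = ∑⊆-zero es
  ∑⊆-shift f es (suc r) = refl

-- `delCon` renumbers vertices at each contraction, so the induction carries the map μ from original
-- to current vertices. Deletion accounts for the sets without the first edge, contraction for those
-- with it, and by `kernel-merge` composing μ with `merge` is gluing on the original vertices.
reversal-delCon : ∀ {N} n (μ : Fin N → Fin n) es →
  Reversal n (delCon n (Vec.map (Product.map μ μ) (fromList es))) (λ r → ∑⊆ (λ A → rankSeries (kernel μ) A r) es)
reversal-delCon n       μ []             = reversal-monomial n
reversal-delCon zero    μ ((i , j) ∷ es) with () ← μ i
reversal-delCon (suc n) μ ((i , j) ∷ es) with μ j Fin.≟ μ i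
-- A loop of the contracted graph leaves the rank unchanged, so the sets with it cancel those
-- without it.
... | yes μj≡μi = reversal-cong (λ r → sym (cancel r)) (reversal-zero λ _ → refl)
  where
  R = kernel μ
  S : Series
  S r = ∑⊆ (λ A → rankSeries R A r) es
  Rij : T (R i j)
  Rij = ≡⇒kernel μ (sym μj≡μi)
  cancel : ∀ r → S r + ∑⊆ (λ A → rankSeries R ((i , j) ∷ A) r) es ≡ 0ℚ
  cancel r = begin
    S r + ∑⊆ (λ A → - step (R i j) (rankSeries (glue R (i , j)) A) r) es
      ≡⟨ cong (S r +_) (∑⊆-cong es λ {A} _ → cong -_ (trans
           (cong (λ t → step t (rankSeries (glue R (i , j)) A) r) (T⇒≡true Rij))
           (rankSeries-cong (glue-redundant (kernel-equiv μ) Rij) A r))) ⟩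
    S r + ∑⊆ (λ A → - rankSeries R A r) es  ≡⟨ cong (S r +_) (∑⊆-neg (λ A → rankSeries R A r) es) ⟩
    S r + - S r                             ≡⟨ ℚ.+-inverseʳ (S r) ⟩
    0ℚ                                      ∎
... | no μj≢μi = reversal-⊕ (reversal-delCon (suc n) μ es) (reversal-cong contracted (reversal-neg (reversal-raise
    (subst (λ cs → Reversal n (delCon n cs) (λ r → ∑⊆ (λ A → rankSeries (kernel μ′) A r) es))
           (Vec.map-∘ (Product.map (merge μj≢μi) (merge μj≢μi)) (Product.map μ μ) (fromList es))
           (reversal-delCon n μ′ es)))))
  where
  R = kernel μ
  μ′ = merge μj≢μi ∘ μ
  contracted : ∀ r → - shift (λ s → ∑⊆ (λ A → rankSeries (kernel μ′) A s) es) r ≡ ∑⊆ (λ A → rankSeries R ((i , j) ∷ A) r) es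
  contracted r = begin
    - shift (λ s → ∑⊆ (λ A → rankSeries (kernel μ′) A s) es) r
      ≡⟨ cong -_ (∑⊆-shift (rankSeries (kernel μ′)) es r) ⟨
    - ∑⊆ (λ A → shift (rankSeries (kernel μ′) A) r) es
      ≡⟨ ∑⊆-neg (λ A → shift (rankSeries (kernel μ′) A) r) es ⟨
    ∑⊆ (λ A → - shift (rankSeries (kernel μ′) A) r) es
      ≡⟨ ∑⊆-cong es (λ {A} _ → cong -_ (trans
           (shift-cong (λ s → sym (rankSeries-cong (kernel-merge μ μj≢μi) A s)) r)
           (cong (λ t → step t (rankSeries (glue R (i , j)) A) r) (sym (¬T⇒≡false (μj≢μi ∘ sym ∘ kernel⇒≡ μ {i} {j})))))) ⟩
    ∑⊆ (λ A → rankSeries R ((i , j) ∷ A) r) es ∎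

chromaticSeries : Graph → Series
chromaticSeries G r = ∑⊆ (λ A → rankSeries (kernel id) A r) (edges G)

reversal-chromaticPolynomial : ∀ G → Reversal (order G) (chromaticPolynomial G) (chromaticSeries G)
reversal-chromaticPolynomial G = subst (λ cs → Reversal (order G) (delCon (order G) cs) (chromaticSeries G))
  (Vec.map-id (fromList (edges G))) (reversal-delCon (order G) id (edges G))

edges-loopless : ∀ G → Loopless (edges G)
edges-loopless G = All.tabulate λ {(u , v)} uv∈ → λ { refl →
  irrefl G u (proj₂ (∈-filter⁻ (λ (u , v) → T? (adj G u v)) {xs = cartesianProduct (allFin _) (allFin _)} uv∈)) }

edges-unique : ∀ G → Unique (edges G)
edges-unique G = Unique.filter⁺ (λ (u , v) → T? (adj G u v))
  (Unique.cartesianProduct⁺ (Unique.allFin⁺ (order G)) (Unique.allFin⁺ (order G)))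

-- Without loops every nonempty edge set has positive rank, so only the empty set contributes in
-- rank 0.
chromaticSeries-monic : ∀ G → chromaticSeries G 0 ≡ 1ℚ
chromaticSeries-monic G = go (edges G) (edges-loopless G)
  where
  go : ∀ es → Loopless es → ∑⊆ (λ A → rankSeries (kernel {order G} id) A 0) es ≡ 1ℚ
  go []             _                  = refl
  go ((i , j) ∷ es) (i≢j ∷ loopless) = cong₂ _+_ (go es loopless) (trans
    (∑⊆-cong es λ {A} _ → cong (λ t → - step t (rankSeries (glue (kernel id) (i , j)) A) 0) (¬T⇒≡false (i≢j ∘ kernel⇒≡ id {i} {j})))
    (∑⊆-zero es))

-- Sums over sets and sums over tuples

sumTo : ℕ → (ℕ → ℚ) → ℚ
sumTo zero    f = 0ℚ
sumTo (suc m) f = f 0 + sumTo m (f ∘ suc)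

sumTo-cong : ∀ m {f g} → f ≗ g → sumTo m f ≡ sumTo m g
sumTo-cong zero    eq = refl
sumTo-cong (suc m) eq = cong₂ _+_ (eq 0) (sumTo-cong m (eq ∘ suc))

sumTo-+ : ∀ m f g → sumTo m (λ s → f s + g s) ≡ sumTo m f + sumTo m g
sumTo-+ zero    f g = refl
sumTo-+ (suc m) f g = trans (cong (f 0 + g 0 +_) (sumTo-+ m (f ∘ suc) (g ∘ suc)))
  (solve 4 (λ a b x y → a :+ b :+ (x :+ y) := a :+ x :+ (b :+ y)) refl (f 0) (g 0) (sumTo m (f ∘ suc)) (sumTo m (g ∘ suc)))

sumTo-zero : ∀ m → sumTo m (λ _ → 0ℚ) ≡ 0ℚ
sumTo-zero zero    = refl
sumTo-zero (suc m) = trans (ℚ.+-identityˡ (sumTo m (λ _ → 0ℚ))) (sumTo-zero m)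

inverseFactorial : ℕ → ℚ
inverseFactorial zero    = 1ℚ
inverseFactorial (suc s) = 1/ fromℕ (suc s) * inverseFactorial s

module _ {E : Set} where

  ∑⊆[_] : ℕ → (List E → ℚ) → List E → ℚ
  ∑⊆[ zero  ] f es       = f []
  ∑⊆[ suc s ] f []       = 0ℚ
  ∑⊆[ suc s ] f (e ∷ es) = ∑⊆[ suc s ] f es + ∑⊆[ s ] (f ∘ (e ∷_)) es

  ∑⊆-bounded : ∀ m f es → (∀ A → m ℕ.≤ length A → f A ≡ 0ℚ) → ∑⊆ f es ≡ sumTo m (λ s → ∑⊆[ s ] f es)
  ∑⊆-bounded zero    f []       z = z [] ℕ.z≤n
  ∑⊆-bounded (suc m) f []       z = sym (trans (cong (f [] +_) (sumTo-zero m)) (ℚ.+-identityʳ (f [])))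
  ∑⊆-bounded zero    f (e ∷ es) z = cong₂ _+_ (∑⊆-bounded zero f es z) (∑⊆-bounded zero (f ∘ (e ∷_)) es λ A _ → z (e ∷ A) ℕ.z≤n)
  ∑⊆-bounded (suc m) f (e ∷ es) z = begin
    ∑⊆ f es + ∑⊆ (f ∘ (e ∷_)) es
      ≡⟨ cong₂ _+_ (∑⊆-bounded (suc m) f es z) (∑⊆-bounded m (f ∘ (e ∷_)) es λ A m≤ → z (e ∷ A) (ℕ.s≤s m≤)) ⟩
    f [] + sumTo m (λ s → ∑⊆[ suc s ] f es) + sumTo m (λ s → ∑⊆[ s ] (f ∘ (e ∷_)) es)
      ≡⟨ ℚ.+-assoc (f []) _ _ ⟩
    f [] + (sumTo m (λ s → ∑⊆[ suc s ] f es) + sumTo m (λ s → ∑⊆[ s ] (f ∘ (e ∷_)) es))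
      ≡⟨ cong (f [] +_) (sumTo-+ m (λ s → ∑⊆[ suc s ] f es) (λ s → ∑⊆[ s ] (f ∘ (e ∷_)) es)) ⟨
    f [] + sumTo m (λ s → ∑⊆[ suc s ] f es + ∑⊆[ s ] (f ∘ (e ∷_)) es) ∎

  ∑-tuples : ℕ → (List E → ℚ) → List E → ℚ
  ∑-tuples zero    f es = f []
  ∑-tuples (suc s) f es = ∑ˡ (λ e → ∑-tuples s (f ∘ (e ∷_)) es) es

  -- Vanishing on repetitions is what allows `∑-tuples` to run over all tuples rather than over
  -- tuples of distinct elements.
  record IsSymmetric (f : List E → ℚ) : Set where
    field
      exchange : ∀ xs a b ys → f (xs ++ a ∷ b ∷ ys) ≡ f (xs ++ b ∷ a ∷ ys)
      repeat   : ∀ xs a ys → f (xs ++ a ∷ a ∷ ys) ≡ 0ℚ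

  open IsSymmetric

  symmetric-∷ : ∀ {f} → IsSymmetric f → ∀ e → IsSymmetric (f ∘ (e ∷_))
  symmetric-∷ sf e .exchange xs = sf .exchange (e ∷ xs)
  symmetric-∷ sf e .repeat xs   = sf .repeat (e ∷ xs)

  ∑ˡ-cong : ∀ {f g : E → ℚ} → f ≗ g → ∀ es → ∑ˡ f es ≡ ∑ˡ g es
  ∑ˡ-cong eq []       = refl
  ∑ˡ-cong eq (e ∷ es) = cong₂ _+_ (eq e) (∑ˡ-cong eq es)

  ∑ˡ-+* : ∀ a (f g : E → ℚ) es → ∑ˡ (λ e → f e + a * g e) es ≡ ∑ˡ f es + a * ∑ˡ g es
  ∑ˡ-+* a f g []       = solve 1 (λ a → con 0ℚ := con 0ℚ :+ a :* con 0ℚ) refl a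
  ∑ˡ-+* a f g (e ∷ es) = trans (cong (f e + a * g e +_) (∑ˡ-+* a f g es))
    (solve 5 (λ a x y z w → x :+ a :* y :+ (z :+ a :* w) := x :+ z :+ a :* (y :+ w)) refl a (f e) (g e) (∑ˡ f es) (∑ˡ g es))

  ∑-tuples-cong : ∀ s {f g} → f ≗ g → ∀ es → ∑-tuples s f es ≡ ∑-tuples s g es
  ∑-tuples-cong zero    eq es = eq []
  ∑-tuples-cong (suc s) eq es = ∑ˡ-cong (λ e → ∑-tuples-cong s (λ A → eq (e ∷ A)) es) es

  ∑-tuples-zero : ∀ s es → ∑-tuples s (λ _ → 0ℚ) es ≡ 0ℚ
  ∑-tuples-zero zero    es = refl
  ∑-tuples-zero (suc s) es = trans (∑ˡ-cong (λ _ → ∑-tuples-zero s es) es) (zeros es)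
    where
    zeros : ∀ es → ∑ˡ {A = E} (λ _ → 0ℚ) es ≡ 0ℚ
    zeros []       = refl
    zeros (e ∷ es) = trans (ℚ.+-identityˡ (∑ˡ {A = E} (λ _ → 0ℚ) es)) (zeros es)

  -- A new element occurs in at most one of the s + 1 positions.
  ∑-tuples-∷ : ∀ s {f} → IsSymmetric f → ∀ e es →
    ∑-tuples (suc s) f (e ∷ es) ≡ ∑-tuples (suc s) f es + fromℕ (suc s) * ∑-tuples s (f ∘ (e ∷_)) es
  ∑-tuples-∷ zero {f} sf e es = solve 2 (λ x y → x :+ y := y :+ con 1ℚ :* x) refl (f (e ∷ [])) (∑ˡ (λ a → f (a ∷ [])) es)
  ∑-tuples-∷ (suc s) {f} sf e es = begin
    ∑-tuples (suc s) (f ∘ (e ∷_)) (e ∷ es) + ∑ˡ (λ a → ∑-tuples (suc s) (f ∘ (a ∷_)) (e ∷ es)) es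
      ≡⟨ cong₂ _+_ (∑-tuples-∷ s (symmetric-∷ sf e) e es) (∑ˡ-cong (λ a → ∑-tuples-∷ s (symmetric-∷ sf a) e es) es) ⟩
    x + k * ∑-tuples s (f ∘ (e ∷_) ∘ (e ∷_)) es +
      ∑ˡ (λ a → ∑-tuples (suc s) (f ∘ (a ∷_)) es + k * ∑-tuples s (f ∘ (a ∷_) ∘ (e ∷_)) es) es
      ≡⟨ cong₂ (λ y z → x + k * y + z)
           (trans (∑-tuples-cong s (sf .repeat [] e) es) (∑-tuples-zero s es))
           (trans (∑ˡ-+* k (λ a → ∑-tuples (suc s) (f ∘ (a ∷_)) es) (λ a → ∑-tuples s (f ∘ (a ∷_) ∘ (e ∷_)) es) es)
             (cong (λ y → t + k * y) (∑ˡ-cong (λ a → ∑-tuples-cong s (sf .exchange [] a e) es) es))) ⟩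
    x + k * 0ℚ + (t + k * x)
      ≡⟨ solve 3 (λ x k t → x :+ k :* con 0ℚ :+ (t :+ k :* x) := t :+ (con 1ℚ :+ k) :* x) refl x k t ⟩
    t + (1ℚ + k) * x
      ≡⟨ cong (λ y → t + y * x) (fromℕ-suc (suc s)) ⟨
    t + fromℕ (suc (suc s)) * x ∎
    where
    k = fromℕ (suc s)
    x = ∑-tuples (suc s) (f ∘ (e ∷_)) es
    t = ∑-tuples (suc (suc s)) f es

  ∑⊆-tuples : ∀ s {f} → IsSymmetric f → ∀ es → ∑⊆[ s ] f es ≡ inverseFactorial s * ∑-tuples s f es
  ∑⊆-tuples zero    {f} sf es       = sym (ℚ.*-identityˡ (f []))
  ∑⊆-tuples (suc s) {f} sf []       = sym (ℚ.*-zeroʳ (inverseFactorial (suc s)))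
  ∑⊆-tuples (suc s) {f} sf (e ∷ es) = begin
    ∑⊆[ suc s ] f es + ∑⊆[ s ] (f ∘ (e ∷_)) es
      ≡⟨ cong₂ _+_ (∑⊆-tuples (suc s) sf es) (∑⊆-tuples s (symmetric-∷ sf e) es) ⟩
    k⁻¹ * i * x + i * y
      ≡⟨ cong (λ z → k⁻¹ * i * x + z) (trans (sym (ℚ.*-identityˡ (i * y))) (cong (_* (i * y)) (sym (ℚ.*-inverseˡ k)))) ⟩
    k⁻¹ * i * x + k⁻¹ * k * (i * y)
      ≡⟨ solve 5 (λ k⁻¹ k i x y → k⁻¹ :* i :* x :+ k⁻¹ :* k :* (i :* y) := k⁻¹ :* i :* (x :+ k :* y)) refl k⁻¹ k i x y ⟩
    k⁻¹ * i * (x + k * y)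
      ≡⟨ cong (k⁻¹ * i *_) (∑-tuples-∷ s sf e es) ⟨
    k⁻¹ * i * ∑-tuples (suc s) f (e ∷ es) ∎
    where
    k = fromℕ (suc s)
    k⁻¹ = 1/ k
    i = inverseFactorial s
    x = ∑-tuples (suc s) f es
    y = ∑-tuples s (f ∘ (e ∷_)) es

-- Tuples of distinct edges

module _ {V : Set} where

  same : Relᴮ V → V × V → V × V → Bool
  same R (a , b) (c , d) = R a c ∧ R b d

  fresh : Relᴮ V → V × V → List (V × V) → Bool
  fresh R e []      = true
  fresh R e (f ∷ A) = not (same R e f) ∧ fresh R e A

  simple : Relᴮ V → List (V × V) → Bool
  simple R []              = true
  simple R (e@(a , b) ∷ A) = (not (R a b) ∧ fresh R e A) ∧ simple R A

  -- `rankSeries` is symmetric but need not vanish on repeated edges; the cut-off supplies that and,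
  -- for R the equality relation, the looplessness behind the rank bound. On sublists of `edges` it
  -- changes nothing.
  simpleRankSeries : Relᴮ V → List (V × V) → Series
  simpleRankSeries R A r = if simple R A then rankSeries R A r else 0ℚ

  module _ {R : Relᴮ V} (E : Equivᴮ R) where
    open Equivᴮ E

    same-sym : ∀ e f → same R e f ≡ same R f e
    same-sym (a , b) (c , d) = cong₂ _∧_ (T-ext symmetric symmetric) (T-ext symmetric symmetric)

    fresh-swap : ∀ x ys e f A → fresh R x (ys ++ e ∷ f ∷ A) ≡ fresh R x (ys ++ f ∷ e ∷ A)
    fresh-swap x (y ∷ ys) e f A = cong (not (same R x y) ∧_) (fresh-swap x ys e f A)
    fresh-swap x []       e f A = x∧yz (not (same R x e)) (not (same R x f)) (fresh R x A)
      where
      x∧yz : ∀ x y z → x ∧ (y ∧ z) ≡ y ∧ (x ∧ z)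
      x∧yz true  y z = refl
      x∧yz false y z = sym (∧-zeroʳ y)

    simple-swap : ∀ xs e f A → simple R (xs ++ e ∷ f ∷ A) ≡ simple R (xs ++ f ∷ e ∷ A)
    simple-swap (x ∷ xs) e f A = cong₂ (λ s t → (not (R (proj₁ x) (proj₂ x)) ∧ s) ∧ t) (fresh-swap x xs e f A) (simple-swap xs e f A)
    simple-swap [] e f A rewrite same-sym e f =
      lemma (not (R (proj₁ e) (proj₂ e))) (not (same R f e)) (fresh R e A) (not (R (proj₁ f) (proj₂ f))) (fresh R f A) (simple R A)
      where
      lemma : ∀ a s b c d t → (a ∧ s ∧ b) ∧ (c ∧ d) ∧ t ≡ (c ∧ s ∧ d) ∧ (a ∧ b) ∧ t
      lemma = solveᴮ 6 (λ a s b c d t → (a ⊕ᴮ s ⊕ᴮ b) ⊕ᴮ (c ⊕ᴮ d) ⊕ᴮ t ⊜ (c ⊕ᴮ s ⊕ᴮ d) ⊕ᴮ (a ⊕ᴮ b) ⊕ᴮ t) refl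

    simple-repeat : ∀ xs e A → simple R (xs ++ e ∷ e ∷ A) ≡ false
    simple-repeat (x ∷ xs) e A = trans (cong ((not (R (proj₁ x) (proj₂ x)) ∧ fresh R x (xs ++ e ∷ e ∷ A)) ∧_) (simple-repeat xs e A)) (∧-zeroʳ _)
    simple-repeat [] e@(a , b) A
      rewrite T⇒≡true (reflexive a) | T⇒≡true (reflexive b) | ∧-zeroʳ (not (R a b)) = refl

    simpleRankSeries-symmetric : ∀ r → IsSymmetric (λ A → simpleRankSeries R A r)
    simpleRankSeries-symmetric r = record
      { exchange = λ xs e f A → cong₂ (λ t x → if t then x else 0ℚ) (simple-swap xs e f A) (rankSeries-swap E xs e f A r)
      ; repeat   = λ xs e A → cong (λ t → if t then rankSeries R (xs ++ e ∷ e ∷ A) r else 0ℚ) (simple-repeat xs e A)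
      }

module _ {V W : Set} (R : Relᴮ W) (g : V → W) where

  pullback : Relᴮ V
  pullback x y = R (g x) (g y)

  pairs : List (V × V) → List (W × W)
  pairs = List.map (Product.map g g)

  fresh-pullback : ∀ e A → fresh R (Product.map g g e) (pairs A) ≡ fresh pullback e A
  fresh-pullback e []      = refl
  fresh-pullback e (f ∷ A) = cong (not (same pullback e f) ∧_) (fresh-pullback e A)

  simple-pullback : ∀ A → simple R (pairs A) ≡ simple pullback A
  simple-pullback []      = refl
  simple-pullback (e ∷ A) = cong₂ (λ s t → (not (pullback (proj₁ e) (proj₂ e)) ∧ s) ∧ t) (fresh-pullback e A) (simple-pullback A)

-- `glue` is a pointwise Boolean formula, so it commutes with pullback by definition. This moves the
-- series from the vertices of `G n`, which vary with n, to the fixed indices of a tuple.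
rankSeries-pullback : ∀ {V W : Set} (R : Relᴮ W) (g : V → W) A → rankSeries R (pairs R g A) ≗ rankSeries (pullback R g) A
rankSeries-pullback R g []            r = refl
rankSeries-pullback R g ((a , b) ∷ A) r = cong -_ (step-cong (R (g a) (g b)) (rankSeries-pullback (glue R (g a , g b)) g A) r)

equality : ∀ m → Relᴮ (Fin m)
equality m = kernel {m} id


T-not⇒¬T : ∀ {b} → T (not b) → ¬ T b
T-not⇒¬T {false} _ ()

¬T⇒T-not : ∀ {b} → ¬ T b → T (not b)
¬T⇒T-not {true}  ¬b = ¬b _
¬T⇒T-not {false} _  = _

length-cartesianProduct : ∀ {A B : Set} (xs : List A) (ys : List B) → length (cartesianProduct xs ys) ≡ length xs ℕ.* length ys
length-cartesianProduct []       ys = refl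
length-cartesianProduct (x ∷ xs) ys = trans (List.length-++ (List.map (x ,_) ys))
  (cong₂ ℕ._+_ (List.length-map (x ,_) ys) (length-cartesianProduct xs ys))

module _ {m : ℕ} where

  private
    R = equality m

  same⇒≡ : ∀ e f → T (same R e f) → e ≡ f
  same⇒≡ (a , b) (c , d) t with p , q ← Equivalence.to (T-∧ {R a c}) t = cong₂ _,_ (kernel⇒≡ id {a} {c} p) (kernel⇒≡ id {b} {d} q)

  ≡⇒same : ∀ e f → e ≡ f → T (same R e f)
  ≡⇒same (a , b) _ refl = Equivalence.from (T-∧ {R a a}) (≡⇒kernel id {a} refl , ≡⇒kernel id {b} refl)

  fresh⇒≢ : ∀ e A → T (fresh R e A) → All (e ≢_) A
  fresh⇒≢ e []      _ = []
  fresh⇒≢ e (f ∷ A) t with p , q ← Equivalence.to (T-∧ {not (same R e f)}) t =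
    T-not⇒¬T p ∘ ≡⇒same e f ∷ fresh⇒≢ e A q

  ≢⇒fresh : ∀ e A → All (e ≢_) A → T (fresh R e A)
  ≢⇒fresh e []      _         = _
  ≢⇒fresh e (f ∷ A) (p ∷ ps) = Equivalence.from (T-∧ {not (same R e f)}) (¬T⇒T-not (p ∘ same⇒≡ e f) , ≢⇒fresh e A ps)

  simple⇒ : ∀ A → T (simple R A) → Unique A × Loopless A
  simple⇒ []              _ = [] , []
  simple⇒ (e@(a , b) ∷ A) t
    with p , q ← Equivalence.to (T-∧ {not (R a b) ∧ fresh R e A}) t
    with loop , new ← Equivalence.to (T-∧ {not (R a b)}) p
    with u , l ← simple⇒ A q = fresh⇒≢ e A new ∷ u , T-not⇒¬T loop ∘ ≡⇒kernel id {a} {b} ∷ l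

  ⇒simple : ∀ A → Unique A → Loopless A → T (simple R A)
  ⇒simple []              _        _        = _
  ⇒simple (e@(a , b) ∷ A) (n ∷ u) (p ∷ l) = Equivalence.from (T-∧ {not (R a b) ∧ fresh R e A})
    (Equivalence.from (T-∧ {not (R a b)}) (¬T⇒T-not (p ∘ kernel⇒≡ id {a} {b}) , ≢⇒fresh e A n) , ⇒simple A u l)

  -- By `rank-support`, started from the empty support of the equality relation, the edges are
  -- distinct ordered pairs from at most 2r vertices; hence the square.
  simple-bounded : ∀ A r → Unique A → Loopless A → rankSeries R A r ≢ 0ℚ → length A ℕ.≤ (r ℕ.+ r) ℕ.* (r ℕ.+ r)
  simple-bounded A r unique loopless ≢0
    with S , _ , len , all ← rank-support A {S = []} r (λ {x} {y} t → inj₁ (kernel⇒≡ id {x} {y} t)) loopless ≢0 =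
    ℕ.≤-trans (unique-length unique λ {(a , b)} ab∈A → uncurry ∈-cartesianProduct⁺ (All.lookup all ab∈A))
    (ℕ.≤-trans (ℕ.≤-reflexive (length-cartesianProduct S S))
      (ℕ.*-mono-≤ (ℕ.≤-trans len (ℕ.≤-reflexive (ℕ.+-identityʳ _))) (ℕ.≤-trans len (ℕ.≤-reflexive (ℕ.+-identityʳ _)))))

  simpleRankSeries-bounded : ∀ r A → suc ((r ℕ.+ r) ℕ.* (r ℕ.+ r)) ℕ.≤ length A → simpleRankSeries R A r ≡ 0ℚ
  simpleRankSeries-bounded r A long with T? (simple R A)
  ... | no ¬simple = cong (if_then rankSeries R A r else 0ℚ) (¬T⇒≡false ¬simple)
  ... | yes t with rankSeries R A r ℚ.≟ 0ℚ
  ...   | yes ≡0 = trans (cong (if_then rankSeries R A r else 0ℚ) (T⇒≡true t)) ≡0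
  ...   | no ≢0  = contradiction (uncurry (simple-bounded A r) (simple⇒ A t) ≢0) (ℕ.<⇒≱ long)

unique-⊆ : ∀ {E : Set} {A es : List E} → A ⊆ es → Unique es → Unique A
unique-⊆ []          []      = []
unique-⊆ (_ ∷ʳ p)    (_ ∷ u) = unique-⊆ p u
unique-⊆ (refl ∷ p)  (n ∷ u) = All-resp-⊆ p n ∷ unique-⊆ p u

chromaticSeries-tuples : ∀ G r → chromaticSeries G r ≡
  sumTo (suc ((r ℕ.+ r) ℕ.* (r ℕ.+ r))) (λ s → inverseFactorial s * ∑-tuples s (λ A → simpleRankSeries (equality (order G)) A r) (edges G))
chromaticSeries-tuples G r = begin
  ∑⊆ (λ A → rankSeries (equality (order G)) A r) (edges G)
    ≡⟨ ∑⊆-cong (edges G) (λ {A} A⊆ → sym (cong (if_then rankSeries (equality (order G)) A r else 0ℚ)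
         (T⇒≡true (⇒simple A (unique-⊆ A⊆ (edges-unique G)) (All-resp-⊆ A⊆ (edges-loopless G)))))) ⟩
  ∑⊆ F (edges G)
    ≡⟨ ∑⊆-bounded M F (edges G) (simpleRankSeries-bounded r) ⟩
  sumTo M (λ s → ∑⊆[ s ] F (edges G))
    ≡⟨ sumTo-cong M (λ s → ∑⊆-tuples s (simpleRankSeries-symmetric (kernel-equiv id) r) (edges G)) ⟩
  sumTo M (λ s → inverseFactorial s * ∑-tuples s F (edges G)) ∎
  where
  -- `sumTo` stops before its bound, and sets of exactly (2r)^2 pairs must still be included.
  M = suc ((r ℕ.+ r) ℕ.* (r ℕ.+ r))
  F : List (Fin (order G) × Fin (order G)) → ℚ
  F A = simpleRankSeries (equality (order G)) A r

-- Edge tuples as vertex tuples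

double : ℕ → ℕ
double zero    = zero
double (suc s) = suc (suc (double s))

skipTwo : ∀ {k} → List (Fin k × Fin k) → List (Fin (suc (suc k)) × Fin (suc (suc k)))
skipTwo = List.map λ (i , j) → suc (suc i) , suc (suc j)

consecutivePairs : ∀ s → List (Fin (double s) × Fin (double s))
consecutivePairs zero    = []
consecutivePairs (suc s) = (zero , suc zero) ∷ skipTwo (consecutivePairs s)

edgeWeight-tail : ∀ G {k} (J : List (Fin k × Fin k)) x y u →
  edgeWeight G (skipTwo J) (x ∷ y ∷ u) ≡ edgeWeight G J u
edgeWeight-tail G []            x y u = refl
edgeWeight-tail G ((i , j) ∷ J) x y u = cong (adjacencyMatrix G (lookup u i) (lookup u j) *_) (edgeWeight-tail G J x y u)

lookupPairs : ∀ {A : Set} {k} → Vec A k → List (Fin k × Fin k) → List (A × A)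
lookupPairs u = List.map (Product.map (lookup u) (lookup u))

∑ˡ-tabulate : ∀ {A : Set} (f : A → ℚ) {k} (h : Fin k → A) → ∑ˡ f (List.tabulate h) ≡ sum (f ∘ h)
∑ˡ-tabulate f {zero}  h = refl
∑ˡ-tabulate f {suc k} h = cong (f (h zero) +_) (∑ˡ-tabulate f (h ∘ suc))

∑ˡ-cartesianProduct : ∀ {A B : Set} (f : A × B → ℚ) {k l} (g : Fin k → A) (h : Fin l → B) →
  ∑ˡ f (cartesianProduct (List.tabulate g) (List.tabulate h)) ≡ sum (λ i → sum (λ j → f (g i , h j)))
∑ˡ-cartesianProduct f {zero}  g h = refl
∑ˡ-cartesianProduct f {suc k} g h = trans
  (∑ˡ-++ f (List.map (g zero ,_) (List.tabulate h)) (cartesianProduct (List.tabulate (g ∘ suc)) (List.tabulate h)))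
  (cong₂ _+_ (trans (∑ˡ-map f (g zero ,_) (List.tabulate h)) (∑ˡ-tabulate (f ∘ (g zero ,_)) h)) (∑ˡ-cartesianProduct f (g ∘ suc) h))

∑ˡ-edges : ∀ G f → ∑ˡ f (edges G) ≡ sum (λ x → sum (λ y → adjacencyMatrix G x y * f (x , y)))
∑ˡ-edges G f = begin
  ∑ˡ f (edges G)
    ≡⟨ ∑ˡ-filter (λ (x , y) → T? (adj G x y)) f (cartesianProduct (allFin _) (allFin _)) ⟩
  ∑ˡ (λ (x , y) → if adj G x y then f (x , y) else 0ℚ) (cartesianProduct (allFin _) (allFin _))
    ≡⟨ ∑ˡ-cartesianProduct (λ (x , y) → if adj G x y then f (x , y) else 0ℚ) {order G} {order G} id id ⟩
  sum (λ x → sum (λ y → if adj G x y then f (x , y) else 0ℚ))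
    ≡⟨ sum-cong-≗ (λ x → sum-cong-≗ λ y → eq (adj G x y) (f (x , y))) ⟩
  sum (λ x → sum (λ y → adjacencyMatrix G x y * f (x , y))) ∎
  where
  eq : ∀ b z → (if b then z else 0ℚ) ≡ [ b ]ᴮ * z
  eq true  z = sym (ℚ.*-identityˡ z)
  eq false z = sym (ℚ.*-zeroˡ z)

-- `double (suc s)` reduces to two further entries, so `∑ᵛ` unfolds into sums over the two ends of
-- the first edge, with adjacency as a weight.
∑-tuples-edges : ∀ G s f → ∑-tuples s f (edges G) ≡
  ∑ᵛ (double s) (λ u → edgeWeight G (consecutivePairs s) u * f (lookupPairs u (consecutivePairs s)))
∑-tuples-edges G zero    f = sym (ℚ.*-identityˡ (f []))
∑-tuples-edges G (suc s) f = trans (∑ˡ-edges G (λ e → ∑-tuples s (f ∘ (e ∷_)) (edges G)))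
  (sum-cong-≗ λ x → sum-cong-≗ λ y → begin
    adjacencyMatrix G x y * ∑-tuples s (f ∘ ((x , y) ∷_)) (edges G)
      ≡⟨ cong (adjacencyMatrix G x y *_) (∑-tuples-edges G s (f ∘ ((x , y) ∷_))) ⟩
    adjacencyMatrix G x y * ∑ᵛ (double s) (λ u → edgeWeight G J u * f ((x , y) ∷ lookupPairs u J))
      ≡⟨ ∑ᵛ-* (double s) (adjacencyMatrix G x y) (λ u → edgeWeight G J u * f ((x , y) ∷ lookupPairs u J)) ⟨
    ∑ᵛ (double s) (λ u → adjacencyMatrix G x y * (edgeWeight G J u * f ((x , y) ∷ lookupPairs u J)))
      ≡⟨ ∑ᵛ-cong (double s) (λ u → trans (sym (ℚ.*-assoc (adjacencyMatrix G x y) (edgeWeight G J u) _))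
           (cong₂ (λ w A → adjacencyMatrix G x y * w * f ((x , y) ∷ A)) (sym (edgeWeight-tail G J x y u)) (List.map-∘ J))) ⟩
    ∑ᵛ (double s) (λ u → edgeWeight G (consecutivePairs (suc s)) (x ∷ y ∷ u) * f (lookupPairs (x ∷ y ∷ u) (consecutivePairs (suc s)))) ∎)
  where J = consecutivePairs s

-- Coefficients of the chromatic polynomial

module ChromaticCoefficients (G : ℕ → Graph) (G-poly : StronglyPolynomial G) where

  open Counting G G-poly

  RelFamily : ℕ → Set
  RelFamily k = ∀ n → Vec (Fin (order (G n))) k → Relᴮ (Fin k)

  DefinableRel : ∀ {k} → RelFamily k → Set
  DefinableRel R = ∀ i j → DefinableBool (λ n u → R n u i j)

  definable-true : ∀ {k} → DefinableBool {k} (λ _ _ → true)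
  definable-true .DefinableBool.indicator = definable-const 1ℚ

  definable-edgeWeight : ∀ {k} (C : List (Fin k × Fin k)) → Definable (λ n u → edgeWeight (G n) C u)
  definable-edgeWeight []            = definable-const 1ℚ
  definable-edgeWeight ((i , j) ∷ C) = definable-* (definable-edge i j) (definable-edgeWeight C)

  module _ {k : ℕ} where

    -- The list `A` of index pairs does not depend on n, so the recursion unfolds to a fixed
    -- formula. R is arbitrary because each step replaces it by a glued relation, again definable.
    definable-rankSeries : ∀ {R : RelFamily k} → DefinableRel R → ∀ A r → Definable (λ n u → rankSeries (R n u) A r)
    definable-rankSeries dR [] r = definable-const (1ˢ r)
    definable-rankSeries {R} dR ((a , b) ∷ A) r = definable-neg (stepped r)
      where
      glued : DefinableRel (λ n u → glue (R n u) (a , b))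
      glued x y = definable-∨ (dR x y) (definable-∨ (definable-∧ (dR x a) (dR b y)) (definable-∧ (dR x b) (dR a y)))
      if-app : ∀ t (f g : Series) r → (if t then f r else g r) ≡ (if t then f else g) r
      if-app true  f g r = refl
      if-app false f g r = refl
      shifted : ∀ r → Definable (λ n u → shift (rankSeries (glue (R n u) (a , b)) A) r)
      shifted zero    = definable-const 0ℚ
      shifted (suc r) = definable-rankSeries glued A r
      stepped : ∀ r → Definable (λ n u → step (R n u a b) (rankSeries (glue (R n u) (a , b)) A) r)
      stepped r = definable-cong (λ n u → if-app (R n u a b) (rankSeries (glue (R n u) (a , b)) A) (shift (rankSeries (glue (R n u) (a , b)) A)) r)
        (definable-if (dR a b) (definable-rankSeries glued A r) (shifted r))

    definable-fresh : ∀ {R : RelFamily k} → DefinableRel R → ∀ e A → DefinableBool (λ n u → fresh (R n u) e A)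
    definable-fresh dR e       []            = definable-true
    definable-fresh dR (a , b) ((c , d) ∷ A) = definable-∧ (definable-not (definable-∧ (dR a c) (dR b d))) (definable-fresh dR (a , b) A)

    definable-simple : ∀ {R : RelFamily k} → DefinableRel R → ∀ A → DefinableBool (λ n u → simple (R n u) A)
    definable-simple dR []            = definable-true
    definable-simple dR ((a , b) ∷ A) = definable-∧ (definable-∧ (definable-not (dR a b)) (definable-fresh dR (a , b) A)) (definable-simple dR A)

  ∑-tuples-isPolynomial : ∀ r s →
    IsPolynomial (λ n → ∑-tuples s (λ A → simpleRankSeries (equality (order (G n))) A r) (edges (G n)))
  ∑-tuples-isPolynomial r s = isPolynomial-cong
    (λ n → trans (∑ᵛ-cong (double s) λ u → cong (edgeWeight (G n) J u *_) (sym (cong₂ (λ t x → if t then x else 0ℚ)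
                   (simple-pullback (equality (order (G n))) (lookup u) J) (rankSeries-pullback (equality (order (G n))) (lookup u) J r))))
                 (sym (∑-tuples-edges (G n) s (λ A → simpleRankSeries (equality (order (G n))) A r))))
    (definable⇒isPolynomial (definable-* (definable-edgeWeight J)
      (definable-if (definable-simple equal J) (definable-rankSeries equal J r) (definable-const 0ℚ))))
    where
    J = consecutivePairs s
    equal : DefinableRel (λ n u → pullback (equality (order (G n))) (lookup u))
    equal = definable-equality

  sumTo-isPolynomial : ∀ m {f : ℕ → ℕ → ℚ} → (∀ s → IsPolynomial (λ n → f n s)) → IsPolynomial (λ n → sumTo m (f n))
  sumTo-isPolynomial zero    _ = isPolynomial-const 0ℚ
  sumTo-isPolynomial (suc m) p = isPolynomial-+ (p 0) (sumTo-isPolynomial m (p ∘ suc))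

  chromaticSeries-isPolynomial : ∀ r → IsPolynomial (λ n → chromaticSeries (G n) r)
  chromaticSeries-isPolynomial r = isPolynomial-cong (λ n → sym (chromaticSeries-tuples (G n) r))
    (sumTo-isPolynomial (suc ((r ℕ.+ r) ℕ.* (r ℕ.+ r))) λ s → isPolynomial-* (isPolynomial-const (inverseFactorial s)) (∑-tuples-isPolynomial r s))

  chromatic-isTwoLevel : IsTwoLevelPolynomialOfInfiniteDepth (λ n → chromaticPolynomial (G n))
  chromatic-isTwoLevel = isTwoLevelOfInfiniteDepth _ (λ n → chromaticSeries (G n)) (λ n → order (G n))
    (λ n → reversal-chromaticPolynomial (G n)) (λ n → chromaticSeries-monic (G n))
    order-isPolynomial chromaticSeries-isPolynomial

theorem3p5 : (G : ℕ → Graph) → StronglyPolynomial G →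
    IsTwoLevelPolynomialOfInfiniteDepth (λ n → chromaticPolynomial (G n)) ×
    IsTwoLevelPolynomialOfInfiniteDepth (λ n → characteristicPolynomial (G n))
theorem3p5 G G-poly =
  ChromaticCoefficients.chromatic-isTwoLevel G G-poly , CharacteristicCoefficients.characteristic-isTwoLevel G G-poly
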